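{- Let $\mathcal{P}$ be the set of integer partitions in which $1$ does not appear as a part and in which, for every positive integer $i$, none of the following occurs as a sub-partition: $i+i+i$; $i+i+(i+1)$; $i+(i+1)+(i+2)+(i+2)$; $i+(i+1)+(i+2)+(i+3)$; $i+(i+1)+(i+1)+(i+3)+(i+3)$. Then, as formal power series in $x,q$, writing $M=i+2j+3k+4l$, $$\sum_{\pi\in\mathcal{P}}x^{\ell(\pi)}q^{|\pi|}=\sum_{i,j,k,l\ge 0}(-1)^l\frac{x^{M}q^{\frac{M(M-1)}{2}+2l^2+2i+3j+5k+6l}}{(q;q)_i\,(q^2;q^2)_j\,(q^3;q^3)_k\,(q^4;q^4)_l}.$$
   Context: Partitions are finite weakly increasing sequences of positive integers (the empty partition is included); $\ell(\pi)$ is the number of parts and $|\pi|$ the sum of the parts of $\pi$. A sub-partition of a partition is a contiguous portion of it. For $n\ge 0$, $(a;q)_n=\prod_{0\le t<n}(1-aq^t)$. All identities are identities of formal power series. -}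

module Defs where

open import Data.Nat as ℕ using (ℕ; zero; suc; _∸_)
open import Data.Integer using (ℤ; 0ℤ; 1ℤ; -1ℤ; _+_; _-_; _*_; _^_)
open import Data.Integer.Properties as ℤₚ using (_≟_)
import Data.Integer.Solver as ℤSolver
open import Data.List using (List; []; _∷_; foldr; map; filter; applyUpTo; length)
open import Data.Nat.ListAction using () renaming (sum to sumℕ)
open import Data.List.Membership.Propositional using (_∈_)
open import Data.List.Membership.Propositional.Properties using (∈-filter⁺; ∈-filter⁻)
open import Data.List.Membership.Propositional.Properties.WithK using (unique∧set⇒bag)
open import Data.List.Relation.Binary.BagAndSetEquality using (∼bag⇒↭)
open import Data.List.Relation.Binary.Infix.Heterogeneous using (Infix)
open import Data.List.Relation.Binary.Permutation.Propositional using (↭⇒↭ₛ)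
open import Data.List.Relation.Binary.Permutation.Propositional.Properties using (map⁺)
import Data.List.Relation.Binary.Permutation.Setoid.Properties as ↭ₛ
open import Data.List.Relation.Unary.All as All using (All)
open import Data.List.Relation.Unary.Linked using (Linked)
open import Data.List.Relation.Unary.Unique.Propositional using (Unique)
import Data.List.Relation.Unary.Unique.Propositional.Properties as Unique
open import Data.Product using (_×_; _,_)
open import Function using (_∘_; mk⇔)
open import Level using (0ℓ)
open import Relation.Binary.PropositionalEquality
open import Relation.Nullary using (¬_; ¬?; yes; no)
open import Relation.Unary using (Pred)

------------------------------------------------------------------------
-- Formal power series

-- f n is the coefficient of qⁿ.
ℤ⟦q⟧ : Set
ℤ⟦q⟧ = ℕ → ℤ

-- F m n is the coefficient of xᵐ qⁿ.
ℤ⟦x,q⟧ : Set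
ℤ⟦x,q⟧ = ℕ → ℕ → ℤ

sumℤ : List ℤ → ℤ
sumℤ = foldr _+_ 0ℤ

infixl 7 _·_ _⊛_ _⊘_
infixl 6 _⊖_
infixr 8 _^ˢ_

𝟙 : ℤ⟦q⟧
𝟙 zero    = 1ℤ
𝟙 (suc _) = 0ℤ

q : ℤ⟦q⟧
q (suc zero) = 1ℤ
q _          = 0ℤ

_⊖_ : ℤ⟦q⟧ → ℤ⟦q⟧ → ℤ⟦q⟧
(f ⊖ g) n = f n - g n

_·_ : ℤ → ℤ⟦q⟧ → ℤ⟦q⟧
(c · f) n = c * f n

_⊛_ : ℤ⟦q⟧ → ℤ⟦q⟧ → ℤ⟦q⟧
(f ⊛ g) n = sumℤ (applyUpTo (λ k → f k * g (n ∸ k)) (suc n))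

_^ˢ_ : ℤ⟦q⟧ → ℕ → ℤ⟦q⟧
f ^ˢ zero  = 𝟙
f ^ˢ suc n = f ⊛ (f ^ˢ n)

-- Long division. It computes the quotient f / g only when g has constant
-- term 1 (see ⊘-correct), which holds for every denominator used below by
-- ⟨﹔⟩-constant.
_⊘_ : ℤ⟦q⟧ → ℤ⟦q⟧ → ℤ⟦q⟧
(f ⊘ g) zero    = f zero
(f ⊘ g) (suc n) = ((λ m → f (suc m) - f zero * g (suc m)) ⊘ g) n

⊘-correct : ∀ f g → g 0 ≡ 1ℤ → ∀ n → ((f ⊘ g) ⊛ g) n ≡ f n
⊘-correct f g g₀ zero = trans (ℤₚ.+-identityʳ _)
  (trans (cong (f 0 *_) g₀) (ℤₚ.*-identityʳ (f 0)))
⊘-correct f g g₀ (suc n) = trans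
  (cong (f 0 * g (suc n) +_)
    (⊘-correct (λ m → f (suc m) - f zero * g (suc m)) g g₀ n))
  (solve 2 (λ a b → a :+ (b :- a) := b) refl (f 0 * g (suc n)) (f (suc n)))
  where open ℤSolver.+-*-Solver

-- (a; b)ₙ = ∏_{0 ≤ t < n} (1 - a bᵗ)
⟨_﹔_⟩ : ℤ⟦q⟧ → ℤ⟦q⟧ → ℕ → ℤ⟦q⟧
⟨ a ﹔ b ⟩ zero    = 𝟙
⟨ a ﹔ b ⟩ (suc n) = ⟨ a ﹔ b ⟩ n ⊛ (𝟙 ⊖ a ⊛ (b ^ˢ n))

⟨﹔⟩-constant : ∀ a b → a 0 ≡ 0ℤ → ∀ n → ⟨ a ﹔ b ⟩ n 0 ≡ 1ℤ
⟨﹔⟩-constant a b a₀ zero = refl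
⟨﹔⟩-constant a b a₀ (suc n)
  rewrite ⟨﹔⟩-constant a b a₀ n | a₀ = refl

-- x^ M · f  is the bivariate series xᴹ f(q).
x^_·_ : ℕ → ℤ⟦q⟧ → ℤ⟦x,q⟧
(x^ M · f) m with m ℕ.≟ M
... | yes _ = f
... | no  _ = λ _ → 0ℤ

-- S = ∑_{i ∈ P} F i as formal power series: for each monomial xᵐ qⁿ only
-- finitely many i ∈ P contribute, and S has the total as its coefficient.
record _IsSumOf_Over_ {I : Set} (S : ℤ⟦x,q⟧) (F : I → ℤ⟦x,q⟧) (P : Pred I 0ℓ) : Set where
  field
    terms    : ℕ → ℕ → List I
    unique   : ∀ m n → Unique (terms m n)
    sound    : ∀ m n → All P (terms m n)
    complete : ∀ m n i → P i → F i m n ≢ 0ℤ → i ∈ terms m n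
    total    : ∀ m n → S m n ≡ sumℤ (map (λ i → F i m n) (terms m n))

IsSumOf-unique : ∀ {I : Set} {F : I → ℤ⟦x,q⟧} {P : Pred I 0ℓ} {S T} →
                 S IsSumOf F Over P → T IsSumOf F Over P → ∀ m n → S m n ≡ T m n
IsSumOf-unique {I} {F} {P} {S} {T} s t m n = begin
  S m n                      ≡⟨ A.total m n ⟩
  Σᶠ (A.terms m n)           ≡⟨ drop-zeros (A.terms m n) ⟨
  Σᶠ (support (A.terms m n)) ≡⟨ ↭ₛ.foldr-commMonoid (setoid ℤ) ℤₚ.+-0-isCommutativeMonoid
                                  (↭⇒↭ₛ (map⁺ f (∼bag⇒↭ (unique∧set⇒bag
                                    (Unique.filter⁺ f≢0? (A.unique m n))
                                    (Unique.filter⁺ f≢0? (B.unique m n))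
                                    (mk⇔ (transfer s t) (transfer t s)))))) ⟩
  Σᶠ (support (B.terms m n)) ≡⟨ drop-zeros (B.terms m n) ⟩
  Σᶠ (B.terms m n)           ≡⟨ B.total m n ⟨
  T m n                      ∎
  where
  open ≡-Reasoning
  module A = _IsSumOf_Over_ s
  module B = _IsSumOf_Over_ t

  f : I → ℤ
  f i = F i m n

  Σᶠ : List I → ℤ
  Σᶠ = sumℤ ∘ map f

  f≢0? = λ i → ¬? (f i ≟ 0ℤ)

  support : List I → List I
  support = filter f≢0?

  drop-zeros : ∀ is → Σᶠ (support is) ≡ Σᶠ is
  drop-zeros [] = refl
  drop-zeros (i ∷ is) with f i ≟ 0ℤ
  ... | yes z = trans (drop-zeros is)
                  (sym (trans (cong (_+ Σᶠ is) z) (ℤₚ.+-identityˡ _)))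
  ... | no  _ = cong (f i +_) (drop-zeros is)

  transfer : ∀ {U V} (u : U IsSumOf F Over P) (v : V IsSumOf F Over P) {i} →
             i ∈ support (_IsSumOf_Over_.terms u m n) →
             i ∈ support (_IsSumOf_Over_.terms v m n)
  transfer u v {i} i∈ with ∈-filter⁻ f≢0? i∈
  ... | i∈u , nz = ∈-filter⁺ f≢0?
    (_IsSumOf_Over_.complete v m n i (All.lookup (_IsSumOf_Over_.sound u m n) i∈u) nz) nz

------------------------------------------------------------------------
-- Partitions

record IsPartition (π : List ℕ) : Set where
  field
    positive   : All (1 ℕ.≤_) π
    increasing : Linked ℕ._≤_ π

_SubPartitionOf_ : List ℕ → List ℕ → Set
_SubPartitionOf_ = Infix _≡_

record 𝒫 (π : List ℕ) : Set where
  field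
    isPartition : IsPartition π
    no-1        : ¬ (1 ∈ π)
    avoids₁     : ∀ i → 1 ℕ.≤ i → ¬ ((i ∷ i ∷ i ∷ []) SubPartitionOf π)
    avoids₂     : ∀ i → 1 ℕ.≤ i → ¬ ((i ∷ i ∷ i ℕ.+ 1 ∷ []) SubPartitionOf π)
    avoids₃     : ∀ i → 1 ℕ.≤ i →
                  ¬ ((i ∷ i ℕ.+ 1 ∷ i ℕ.+ 2 ∷ i ℕ.+ 2 ∷ []) SubPartitionOf π)
    avoids₄     : ∀ i → 1 ℕ.≤ i →
                  ¬ ((i ∷ i ℕ.+ 1 ∷ i ℕ.+ 2 ∷ i ℕ.+ 3 ∷ []) SubPartitionOf π)
    avoids₅     : ∀ i → 1 ℕ.≤ i →
                  ¬ ((i ∷ i ℕ.+ 1 ∷ i ℕ.+ 1 ∷ i ℕ.+ 3 ∷ i ℕ.+ 3 ∷ []) SubPartitionOf π)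

partitionTerm : List ℕ → ℤ⟦x,q⟧
partitionTerm π = x^ length π · (q ^ˢ sumℕ π)

------------------------------------------------------------------------
-- The quadruple series

quadrupleTerm : ℕ × ℕ × ℕ × ℕ → ℤ⟦x,q⟧
quadrupleTerm (i , j , k , l) = x^ M · (((-1ℤ ^ l) · (q ^ˢ E)) ⊘ D)
  where
  M = i ℕ.+ 2 ℕ.* j ℕ.+ 3 ℕ.* k ℕ.+ 4 ℕ.* l
  E = M ℕ.* (M ∸ 1) ℕ./ 2 ℕ.+ 2 ℕ.* l ℕ.^ 2 ℕ.+ 2 ℕ.* i ℕ.+ 3 ℕ.* j ℕ.+ 5 ℕ.* k ℕ.+ 6 ℕ.* l
  D = ⟨ q ﹔ q ⟩ i ⊛ ⟨ q ^ˢ 2 ﹔ q ^ˢ 2 ⟩ j ⊛ ⟨ q ^ˢ 3 ﹔ q ^ˢ 3 ⟩ k ⊛ ⟨ q ^ˢ 4 ﹔ q ^ˢ 4 ⟩ l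

{-# OPTIONS --safe #-}
module Submission where

-- Let G_b be the generating function of the partitions with parts ≥ b that avoid the
-- patterns. Splitting off the initial run (b, b,b, b,b+1, b,b+1,b+2 or b,b+1,b+1) gives
--   G_b = G_{b+1} + xq^b (1 + xq^b) G_{b+2} + x²q^{2b+1} (1 + xq^{b+1}) G_{b+3}
--           + x³q^{3b+3} G_{b+4} - x⁵q^{5b+8} G_{b+5},
-- where the negative term accounts for b,b+1,b+1 not being followed by b+3,b+3.
-- On the other side, Euler's expansions identify the quadruple sum without its factor
-- q^{M(M-1)/2 + M} as the coefficient of z^M in
--   Φ(z) = (z⁴q⁴; q⁴) / ((zq; q) (z²q; q²) (z³q²; q³))    (infinite products),
-- and Φ(z) (1 - zq) (1 - z²q) (1 - z³q²) = Φ(qz) (1 - z⁴q⁴). As 1 - zq divides 1 - z⁴q⁴,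
--   (1 + α + α² + α³) Φ(qz) = (1 - qz²) (1 - q²z³) Φ(z),    α = qz,
-- and weighting the coefficient of z^m by q^{m(m-1)/2 + (b-1)m} turns this into the
-- recurrence for G_b, which determines the G_b since G_b ≡ 1 modulo q^b.

open import Defs
open import Data.Product using (∃-syntax; _×_)
open import Relation.Unary using (U)

open import Algebra.Bundles using (CommutativeRing)
import Algebra.Construct.Pointwise as Pointwise
import Algebra.Properties.AbelianGroup as AbelianGroupProperties
import Algebra.Properties.Ring as RingProperties
import Algebra.Properties.Semiring.Exp as Exp
import Algebra.Solver.Ring.NaturalCoefficients.Default as RingSolver
open import Data.Integer as ℤ using (ℤ; 0ℤ; 1ℤ; -1ℤ; +_)
import Data.Integer.Properties as ℤₚ
open import Data.List
  using (List; []; _∷_; foldr; map; _++_; length; concat; applyUpTo; cartesianProduct)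
import Data.List.Properties as Listₚ
open import Data.List.Membership.Propositional using (_∈_)
open import Data.List.Membership.Propositional.Properties
  using (∈-++⁺ˡ; ∈-++⁺ʳ; ∈-++⁻; ∈-map⁺; ∈-map⁻; ∈-concat⁺′; ∈-concat⁻′; ∈-applyUpTo⁺; ∈-applyUpTo⁻;
         ∈-cartesianProduct⁺; ∈-cartesianProduct⁻)
import Data.List.Relation.Binary.Infix.Heterogeneous as Infix
open import Data.List.Relation.Binary.Prefix.Heterogeneous using (Prefix; []; _∷_)
open import Data.List.Relation.Unary.All as All using (All; []; _∷_)
import Data.List.Relation.Unary.All.Properties as Allₚ
open import Data.List.Relation.Unary.AllPairs using ([]; _∷_)
import Data.List.Relation.Unary.AllPairs.Properties as AllPairsₚ
open import Data.List.Relation.Unary.Any using (here; there)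
open import Data.List.Relation.Unary.Linked using (Linked; []; [-]; _∷_)
open import Data.List.Relation.Unary.Unique.Propositional using (Unique)
import Data.List.Relation.Unary.Unique.Propositional.Properties as Uniqueₚ
open import Data.Nat as ℕ using (ℕ; zero; suc; _∸_; _≤_; _<_; s≤s; z≤n)
import Data.Nat.DivMod as DivMod
open import Data.Nat.Divisibility using (_∣_; divides; _∣?_; ∣-refl; ∣m∣n⇒∣m+n)
open import Data.Nat.ListAction using () renaming (sum to sumℕ)
import Data.Nat.Properties as ℕₚ
open import Data.Nat.Solver using (module +-*-Solver)
open import Data.Product using (_,_; proj₁; proj₂)
open import Data.Sum using (_⊎_; inj₁; inj₂)
open import Data.Unit using (tt)
open import Function using (_∘_)
open import Level using (Level; 0ℓ)
open import Relation.Binary.Definitions using (tri<; tri≈; tri>)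
open import Relation.Binary.PropositionalEquality as ≡ using (_≡_; _≢_)
open import Relation.Nullary using (¬_; yes; no; contradiction)
open import Relation.Unary using (Pred; _∪_; _∩_; ∁; _≐_; _⊆_)

-- Formal power series over a commutative ring

module PowerSeries {c ℓ : Level} (R : CommutativeRing c ℓ) where
  open CommutativeRing R
  open import Relation.Binary.Reasoning.Setoid setoid
  open RingSolver commutativeSemiring

  Series : Set c
  Series = ℕ → Carrier

  infix  4 _≋_
  infixl 7 _⊗_ _⊙_

  _≋_ : Series → Series → Set ℓ
  f ≋ g = ∀ n → f n ≈ g n

  pointwiseRing : CommutativeRing c ℓ
  pointwiseRing = Pointwise.commutativeRing ℕ R

  open CommutativeRing pointwiseRing using ()
    renaming (_+_ to _⊕_; 0# to 𝟘; +-isAbelianGroup to ⊕-isAbelianGroup)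

  tail : Series → Series
  tail f n = f (suc n)

  _⊙_ : Carrier → Series → Series
  (c ⊙ f) n = c * f n

  const : Carrier → Series
  const c zero    = c
  const c (suc n) = 0#

  X : Series
  X (suc zero) = 1#
  X _          = 0#

  -- The Cauchy product, written as f g = f₀ g + X (tail f) g; the ring laws then follow by
  -- induction on the index of the coefficient.
  _⊗_ : Series → Series → Series
  (f ⊗ g) zero    = f 0 * g 0
  (f ⊗ g) (suc n) = f 0 * g (suc n) + (tail f ⊗ g) n

  ⊗-cong : ∀ {f f′ g g′} → f ≋ f′ → g ≋ g′ → f ⊗ g ≋ f′ ⊗ g′
  ⊗-cong p q zero    = *-cong (p 0) (q 0)
  ⊗-cong p q (suc n) = +-cong (*-cong (p 0) (q (suc n))) (⊗-cong (λ i → p (suc i)) q n)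

  ⊗-distribʳ : ∀ h f g → (f ⊕ g) ⊗ h ≋ (f ⊗ h) ⊕ (g ⊗ h)
  ⊗-distribʳ h f g zero    = distribʳ _ _ _
  ⊗-distribʳ h f g (suc n) = begin
    (f 0 + g 0) * h (suc n) + ((tail f ⊕ tail g) ⊗ h) n
      ≈⟨ +-congˡ (⊗-distribʳ h (tail f) (tail g) n) ⟩
    (f 0 + g 0) * h (suc n) + ((tail f ⊗ h) n + (tail g ⊗ h) n)
      ≈⟨ solve 5 (λ a b c d e → (a :+ b) :* c :+ (d :+ e) := (a :* c :+ d) :+ (b :* c :+ e))
           refl (f 0) (g 0) (h (suc n)) _ _ ⟩
    (f 0 * h (suc n) + (tail f ⊗ h) n) + (g 0 * h (suc n) + (tail g ⊗ h) n) ∎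

  ⊙-⊗ : ∀ c f g → (c ⊙ f) ⊗ g ≋ c ⊙ (f ⊗ g)
  ⊙-⊗ c f g zero    = *-assoc _ _ _
  ⊙-⊗ c f g (suc n) = begin
    c * f 0 * g (suc n) + ((c ⊙ tail f) ⊗ g) n   ≈⟨ +-cong (*-assoc _ _ _) (⊙-⊗ c (tail f) g n) ⟩
    c * (f 0 * g (suc n)) + c * (tail f ⊗ g) n   ≈⟨ distribˡ _ _ _ ⟨
    c * (f 0 * g (suc n) + (tail f ⊗ g) n)       ∎

  ⊗-assoc : ∀ f g h → (f ⊗ g) ⊗ h ≋ f ⊗ (g ⊗ h)
  ⊗-assoc f g h zero    = *-assoc _ _ _
  ⊗-assoc f g h (suc n) = begin
    f 0 * g 0 * h (suc n) + (((f 0 ⊙ tail g) ⊕ (tail f ⊗ g)) ⊗ h) n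
      ≈⟨ +-congˡ (⊗-distribʳ h (f 0 ⊙ tail g) (tail f ⊗ g) n) ⟩
    f 0 * g 0 * h (suc n) + (((f 0 ⊙ tail g) ⊗ h) n + ((tail f ⊗ g) ⊗ h) n)
      ≈⟨ +-congˡ (+-cong (⊙-⊗ (f 0) (tail g) h n) (⊗-assoc (tail f) g h n)) ⟩
    f 0 * g 0 * h (suc n) + (f 0 * (tail g ⊗ h) n + (tail f ⊗ (g ⊗ h)) n)
      ≈⟨ solve 5 (λ a b c d e → a :* b :* c :+ (a :* d :+ e) := a :* (b :* c :+ d) :+ e)
           refl (f 0) (g 0) (h (suc n)) _ _ ⟩
    f 0 * (g 0 * h (suc n) + (tail g ⊗ h) n) + (tail f ⊗ (g ⊗ h)) n ∎

  -- The defining recursion takes apart the first factor. Taking apart the second one instead is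
  -- what the induction for commutativity needs.
  ⊗-sucʳ : ∀ f g n → (f ⊗ g) (suc n) ≈ (f ⊗ tail g) n + f (suc n) * g 0
  ⊗-sucʳ f g zero    = refl
  ⊗-sucʳ f g (suc n) = begin
    f 0 * g (2 ℕ.+ n) + (tail f ⊗ g) (suc n)
      ≈⟨ +-congˡ (⊗-sucʳ (tail f) g n) ⟩
    f 0 * g (2 ℕ.+ n) + ((tail f ⊗ tail g) n + f (2 ℕ.+ n) * g 0)
      ≈⟨ +-assoc _ _ _ ⟨
    (f 0 * g (2 ℕ.+ n) + (tail f ⊗ tail g) n) + f (2 ℕ.+ n) * g 0 ∎

  ⊗-comm : ∀ f g → f ⊗ g ≋ g ⊗ f
  ⊗-comm f g zero    = *-comm _ _
  ⊗-comm f g (suc n) = begin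
    f 0 * g (suc n) + (tail f ⊗ g) n  ≈⟨ +-comm _ _ ⟩
    (tail f ⊗ g) n + f 0 * g (suc n)  ≈⟨ +-cong (⊗-comm (tail f) g n) (*-comm _ _) ⟩
    (g ⊗ tail f) n + g (suc n) * f 0  ≈⟨ ⊗-sucʳ g f n ⟨
    (g ⊗ f) (suc n)                   ∎

  𝟘⊗ : ∀ f → 𝟘 ⊗ f ≋ 𝟘
  𝟘⊗ f zero    = zeroˡ _
  𝟘⊗ f (suc n) = trans (+-cong (zeroˡ _) (𝟘⊗ f n)) (+-identityˡ _)

  const⊗ : ∀ c f → const c ⊗ f ≋ c ⊙ f
  const⊗ c f zero    = refl
  const⊗ c f (suc n) = trans (+-congˡ (𝟘⊗ f n)) (+-identityʳ _)

  1⊗ : ∀ f → const 1# ⊗ f ≋ f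
  1⊗ f n = trans (const⊗ 1# f n) (*-identityˡ _)

  X⊗-zero : ∀ f → (X ⊗ f) 0 ≈ 0#
  X⊗-zero f = zeroˡ _

  X⊗-suc : ∀ f n → (X ⊗ f) (suc n) ≈ f n
  X⊗-suc f n = trans (+-congʳ (zeroˡ _)) (trans (+-identityˡ _)
                 (trans (⊗-cong tail-X (λ _ → refl) n) (1⊗ f n)))
    where
    tail-X : tail X ≋ const 1#
    tail-X zero    = refl
    tail-X (suc n) = refl

  const-* : ∀ a b → const (a * b) ≋ const a ⊗ const b
  const-* a b zero    = refl
  const-* a b (suc n) = sym (trans (const⊗ a (const b) (suc n)) (zeroʳ _))

  seriesRing : CommutativeRing c ℓ
  seriesRing = record
    { Carrier = Series
    ; _≈_ = _≋_
    ; _+_ = _⊕_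
    ; _*_ = _⊗_
    ; -_  = CommutativeRing.-_ pointwiseRing
    ; 0#  = 𝟘
    ; 1#  = const 1#
    ; isCommutativeRing = record
      { isRing = record
        { +-isAbelianGroup = ⊕-isAbelianGroup
        ; *-cong     = ⊗-cong
        ; *-assoc    = ⊗-assoc
        ; *-identity = 1⊗ , λ f n → trans (⊗-comm f (const 1#) n) (1⊗ f n)
        ; distrib    = (λ h f g n → trans (⊗-comm h (f ⊕ g) n)
                         (trans (⊗-distribʳ h f g n) (+-cong (⊗-comm f h n) (⊗-comm g h n))))
                     , ⊗-distribʳ
        }
      ; *-comm = ⊗-comm
      }
    }

  -- Links the recursive product with the explicit convolution sum, which is the form of `⊛` and of
  -- sums over `convolve`.
  ⊗-applyUpTo : ∀ f g n → (f ⊗ g) n ≈ foldr _+_ 0# (applyUpTo (λ k → f k * g (n ∸ k)) (suc n))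
  ⊗-applyUpTo f g zero    = sym (+-identityʳ _)
  ⊗-applyUpTo f g (suc n) = +-congˡ (⊗-applyUpTo (tail f) g n)

-- Identities in commutative rings

module Identities {c ℓ : Level} (R : CommutativeRing c ℓ) where
  open CommutativeRing R
  open import Relation.Binary.Reasoning.Setoid setoid
  open RingSolver commutativeSemiring
  open RingProperties ring using (-‿distribˡ-*)
  open AbelianGroupProperties +-abelianGroup using (∙-cancelʳ)

  -- Here the `e`s stand for the four factors of Φ(z) and the `s`s for the same factors at qz. The
  -- conclusion is (1 + α + α² + α³) s = (1 - β)(1 - γ) e, with negative terms moved across so that
  -- the semiring solver applies.
  product-equation : ∀ α β γ {e₁ e₂ e₃ e₄ s₁ s₂ s₃ s₄} →
    e₁ ≈ s₁ + α * e₁ → e₂ ≈ s₂ + β * e₂ → e₃ ≈ s₃ + γ * e₃ →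
    e₄ + α * (α * (α * (α * s₄))) ≈ s₄ →
    let e = e₁ * (e₂ * (e₃ * e₄))
        s = s₁ * (s₂ * (s₃ * s₄))
    in s + α * s + α * (α * s) + α * (α * (α * s)) + (β * e + γ * e) ≈ e + γ * (β * e)
  product-equation α β γ {e₁} {e₂} {e₃} {e₄} {s₁} {s₂} {s₃} {s₄} h₁ h₂ h₃ h₄ = begin
    s + α * s + α * (α * s) + α * (α * (α * s)) + (β * e + γ * e)  ≈⟨ +-congʳ geometric ⟩
    e₁ * (s₂ * (s₃ * e₄)) + (β * e + γ * e)
      ≈⟨ solve 8 (λ β γ e₁ e₂ e₃ e₄ s₂ s₃ →
            e₁ :* (s₂ :* (s₃ :* e₄))
              :+ (β :* (e₁ :* (e₂ :* (e₃ :* e₄))) :+ γ :* (e₁ :* (e₂ :* (e₃ :* e₄))))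
            := e₁ :* e₄ :* (s₂ :* s₃ :+ β :* e₂ :* e₃ :+ γ :* e₃ :* e₂))
          refl β γ e₁ e₂ e₃ e₄ s₂ s₃ ⟩
    e₁ * e₄ * (s₂ * s₃ + β * e₂ * e₃ + γ * e₃ * e₂)  ≈⟨ *-congˡ split ⟩
    e₁ * e₄ * (e₂ * e₃ + β * e₂ * (γ * e₃))
      ≈⟨ solve 6 (λ β γ e₁ e₂ e₃ e₄ →
            e₁ :* e₄ :* (e₂ :* e₃ :+ β :* e₂ :* (γ :* e₃))
            := e₁ :* (e₂ :* (e₃ :* e₄)) :+ γ :* (β :* (e₁ :* (e₂ :* (e₃ :* e₄)))))
          refl β γ e₁ e₂ e₃ e₄ ⟩
    e + γ * (β * e) ∎
    where
    e = e₁ * (e₂ * (e₃ * e₄))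
    s = s₁ * (s₂ * (s₃ * s₄))
    t = s₂ * (s₃ * s₄)

    telescope : e₁ ≈ s₁ + α * s₁ + α * (α * s₁) + α * (α * (α * s₁)) + α * (α * (α * (α * e₁)))
    telescope = begin
      e₁                      ≈⟨ h₁ ⟩
      s₁ + α * e₁             ≈⟨ +-congˡ (*-congˡ h₁) ⟩
      s₁ + α * (s₁ + α * e₁)  ≈⟨ +-congˡ (*-congˡ (+-congˡ (*-congˡ h₁))) ⟩
      s₁ + α * (s₁ + α * (s₁ + α * e₁))
        ≈⟨ +-congˡ (*-congˡ (+-congˡ (*-congˡ (+-congˡ (*-congˡ h₁))))) ⟩
      s₁ + α * (s₁ + α * (s₁ + α * (s₁ + α * e₁)))
        ≈⟨ solve 3 (λ α e s → s :+ α :* (s :+ α :* (s :+ α :* (s :+ α :* e)))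
             := s :+ α :* s :+ α :* (α :* s) :+ α :* (α :* (α :* s)) :+ α :* (α :* (α :* (α :* e))))
             refl α e₁ s₁ ⟩
      s₁ + α * s₁ + α * (α * s₁) + α * (α * (α * s₁)) + α * (α * (α * (α * e₁))) ∎

    geometric : s + α * s + α * (α * s) + α * (α * (α * s)) ≈ e₁ * (s₂ * (s₃ * e₄))
    -- After adding α⁴ e₁ t both sides equal e₁ t: the left one by four uses of `h₁`, the right one
    -- by `h₄`. This takes the place of dividing 1 - α⁴ by 1 - α.
    geometric = ∙-cancelʳ (α * (α * (α * (α * (e₁ * t))))) _ _ (begin
      s + α * s + α * (α * s) + α * (α * (α * s)) + α * (α * (α * (α * (e₁ * t))))
        ≈⟨ solve 4 (λ α e₁ s₁ t →
             s₁ :* t :+ α :* (s₁ :* t) :+ α :* (α :* (s₁ :* t)) :+ α :* (α :* (α :* (s₁ :* t)))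
               :+ α :* (α :* (α :* (α :* (e₁ :* t))))
             := (s₁ :+ α :* s₁ :+ α :* (α :* s₁) :+ α :* (α :* (α :* s₁))
                  :+ α :* (α :* (α :* (α :* e₁)))) :* t)
           refl α e₁ s₁ t ⟩
      (s₁ + α * s₁ + α * (α * s₁) + α * (α * (α * s₁)) + α * (α * (α * (α * e₁)))) * t
        ≈⟨ *-congʳ telescope ⟨
      e₁ * (s₂ * (s₃ * s₄))
        ≈⟨ *-congˡ (*-congˡ (*-congˡ h₄)) ⟨
      e₁ * (s₂ * (s₃ * (e₄ + α * (α * (α * (α * s₄))))))
        ≈⟨ solve 6 (λ α e₁ e₄ s₂ s₃ s₄ →
             e₁ :* (s₂ :* (s₃ :* (e₄ :+ α :* (α :* (α :* (α :* s₄))))))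
             := e₁ :* (s₂ :* (s₃ :* e₄)) :+ α :* (α :* (α :* (α :* (e₁ :* (s₂ :* (s₃ :* s₄)))))))
           refl α e₁ e₄ s₂ s₃ s₄ ⟩
      e₁ * (s₂ * (s₃ * e₄)) + α * (α * (α * (α * (e₁ * t)))) ∎)

    -- This is s₂ s₃ = (1 - β) e₂ (1 - γ) e₃ in subtraction-free form.
    split : s₂ * s₃ + β * e₂ * e₃ + γ * e₃ * e₂ ≈ e₂ * e₃ + β * e₂ * (γ * e₃)
    split = begin
      s₂ * s₃ + β * e₂ * e₃ + γ * e₃ * e₂
        ≈⟨ +-cong (+-congˡ (*-congˡ h₃)) (*-congˡ h₂) ⟩
      s₂ * s₃ + β * e₂ * (s₃ + γ * e₃) + γ * e₃ * (s₂ + β * e₂)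
        ≈⟨ solve 4 (λ x y s t → s :* t :+ x :* (t :+ y) :+ y :* (s :+ x)
             := (s :+ x) :* (t :+ y) :+ x :* y)
           refl (β * e₂) (γ * e₃) s₂ s₃ ⟩
      (s₂ + β * e₂) * (s₃ + γ * e₃) + β * e₂ * (γ * e₃)
        ≈⟨ +-congʳ (*-cong h₂ h₃) ⟨
      e₂ * e₃ + β * e₂ * (γ * e₃) ∎

  -- As i = 1/d and i′ = 1/d′ with d′ = d (1 - b), it follows that (1 - b) i′ = i.
  inverse-step : ∀ {d d′ i i′ b} → i * d ≈ 1# → i′ * d′ ≈ 1# → d′ ≈ d * (1# + - b) → i′ ≈ i + b * i′
  inverse-step {d} {d′} {i} {i′} {b} id≈1 i′d′≈1 d′≈ = sym (begin
    i + b * i′                             ≈⟨ +-congʳ (*-identityʳ i) ⟨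
    i * 1# + b * i′                        ≈⟨ +-congʳ (*-congˡ i′d′≈1) ⟨
    i * (i′ * d′) + b * i′                 ≈⟨ +-congʳ (*-congˡ (*-congˡ d′≈)) ⟩
    i * (i′ * (d * (1# + - b))) + b * i′
      ≈⟨ solve 5 (λ i i′ d c b → i :* (i′ :* (d :* c)) :+ b :* i′ := i :* d :* (c :* i′) :+ b :* i′)
           refl i i′ d (1# + - b) b ⟩
    i * d * ((1# + - b) * i′) + b * i′     ≈⟨ +-congʳ (trans (*-congʳ id≈1) (*-identityˡ _)) ⟩
    (1# + - b) * i′ + b * i′               ≈⟨ distribʳ _ _ _ ⟨
    (1# + - b + b) * i′
      ≈⟨ *-congʳ (trans (+-assoc _ _ _) (trans (+-congˡ (-‿inverseˡ b)) (+-identityʳ 1#))) ⟩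
    1# * i′                                ≈⟨ *-identityˡ i′ ⟩
    i′                                     ∎)

  quotient-of-product : ∀ {d₁ d₂ d₃ d₄ i₁ i₂ i₃ i₄ s₁ s₂ s₃ s₄ t u} →
    i₁ * d₁ ≈ 1# → i₂ * d₂ ≈ 1# → i₃ * d₃ ≈ 1# → i₄ * d₄ ≈ 1# →
    u * (d₁ * d₂ * d₃ * d₄) ≈ t * (s₁ * (s₂ * (s₃ * s₄))) →
    u ≈ t * (s₁ * i₁ * (s₂ * i₂ * (s₃ * i₃ * (s₄ * i₄))))
  quotient-of-product {d₁} {d₂} {d₃} {d₄} {i₁} {i₂} {i₃} {i₄} {s₁} {s₂} {s₃} {s₄} {t} {u}
    h₁ h₂ h₃ h₄ h = begin
    u ≈⟨ solve 1 (λ u → u := u :* (con 1 :* (con 1 :* (con 1 :* con 1)))) refl u ⟩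
    u * (1# * (1# * (1# * 1#))) ≈⟨ *-congˡ (*-cong h₁ (*-cong h₂ (*-cong h₃ h₄))) ⟨
    u * (i₁ * d₁ * (i₂ * d₂ * (i₃ * d₃ * (i₄ * d₄))))
      ≈⟨ solve 9 (λ u i₁ i₂ i₃ i₄ d₁ d₂ d₃ d₄ →
           u :* (i₁ :* d₁ :* (i₂ :* d₂ :* (i₃ :* d₃ :* (i₄ :* d₄))))
           := u :* (d₁ :* d₂ :* d₃ :* d₄) :* (i₁ :* i₂ :* i₃ :* i₄))
         refl u i₁ i₂ i₃ i₄ d₁ d₂ d₃ d₄ ⟩
    u * (d₁ * d₂ * d₃ * d₄) * (i₁ * i₂ * i₃ * i₄) ≈⟨ *-congʳ h ⟩
    t * (s₁ * (s₂ * (s₃ * s₄))) * (i₁ * i₂ * i₃ * i₄)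
      ≈⟨ solve 9 (λ t i₁ i₂ i₃ i₄ s₁ s₂ s₃ s₄ →
           t :* (s₁ :* (s₂ :* (s₃ :* s₄))) :* (i₁ :* i₂ :* i₃ :* i₄)
           := t :* (s₁ :* i₁ :* (s₂ :* i₂ :* (s₃ :* i₃ :* (s₄ :* i₄)))))
         refl t i₁ i₂ i₃ i₄ s₁ s₂ s₃ s₄ ⟩
    t * (s₁ * i₁ * (s₂ * i₂ * (s₃ * i₃ * (s₄ * i₄)))) ∎

  weighted-step : ∀ {i i′ u} y w → i′ ≈ i + u * i′ → y * w * i′ ≈ u * (y * w * i′) + y * (w * i)
  weighted-step {i} {i′} {u} y w h = trans (*-congˡ h)
    (solve 5 (λ i i′ u y w → y :* w :* (i :+ u :* i′) := u :* (y :* w :* i′) :+ y :* (w :* i))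
      refl i i′ u y w)

  -- The hypotheses say (1 - u) i′ = i and z′ = - u z, so (u - 1) z′ i′ = - z′ i = u z i.
  signed-step : ∀ {i i′ u z z′} → i′ ≈ i + u * i′ → z′ + u * z ≈ 0# →
    u * (z′ * i′) ≈ z′ * i′ + u * (z * i)
  signed-step {i} {i′} {u} {z} {z′} h cancel = begin
    u * (z′ * i′)                          ≈⟨ +-identityʳ _ ⟨
    u * (z′ * i′) + 0#                     ≈⟨ +-congˡ (trans (*-congʳ cancel) (zeroˡ i)) ⟨
    u * (z′ * i′) + (z′ + u * z) * i
      ≈⟨ solve 5 (λ i i′ u z z′ → u :* (z′ :* i′) :+ (z′ :+ u :* z) :* i
           := z′ :* (i :+ u :* i′) :+ u :* (z :* i)) refl i i′ u z z′ ⟩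
    z′ * (i + u * i′) + u * (z * i)        ≈⟨ +-congʳ (*-congˡ h) ⟨
    z′ * i′ + u * (z * i)                  ∎

  rearrange₄ : ∀ q u e → q * (q * (q * (q * u))) * e ≈ q * (q * (q * q)) * (u * e)
  rearrange₄ = solve 3 (λ q u e →
    q :* (q :* (q :* (q :* u))) :* e := q :* (q :* (q :* q)) :* (u :* e)) refl

  negate-middle : ∀ a b c → - (a * (b * c)) ≈ - b * (a * c)
  negate-middle a b c = trans (-‿cong (solve 3 (λ a b c → a :* (b :* c) := b :* (a :* c)) refl a b c))
    (-‿distribˡ-* b (a * c))

  pull-out : ∀ a b c d e f → a * (b * (c * (d * (e * f)))) ≈ e * (a * (b * (c * (d * f))))
  pull-out = solve 6 (λ a b c d e f →
    a :* (b :* (c :* (d :* (e :* f)))) := e :* (a :* (b :* (c :* (d :* f))))) refl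

  -- In the application v i = qⁱ, and A i, H i, B′ i, C i are the generating functions of
  -- Partition≥ b, NotTwice b, After₁ b and After₁₁ b with b = 1 + i.
  module Recurrences (X : Carrier) (v : ℕ → Carrier) where

    infixr 8 ⟪_⟫_

    -- Multiplication by x qⁱ, the effect on a generating function of putting a part `i` in front.
    ⟪_⟫_ : ℕ → Carrier → Carrier
    ⟪ i ⟫ f = X * (v i * f)

    ⟪⟫-cong : ∀ i {f g} → f ≈ g → ⟪ i ⟫ f ≈ ⟪ i ⟫ g
    ⟪⟫-cong i p = *-congˡ (*-congˡ p)

    module _ (A H : ℕ → Carrier) where

      C B′ : ℕ → Carrier
      C i  = ⟪ 1 ℕ.+ i ⟫ H (2 ℕ.+ i) + (⟪ 2 ℕ.+ i ⟫ A (3 ℕ.+ i) + A (2 ℕ.+ i))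
      B′ i = ⟪ 2 ℕ.+ i ⟫ C (1 ℕ.+ i) + A (2 ℕ.+ i)

      record Solution : Set ℓ where
        field
          A-recurrence : ∀ i → A i ≈ ⟪ 1 ℕ.+ i ⟫ (⟪ 1 ℕ.+ i ⟫ A (2 ℕ.+ i) + B′ i) + A (1 ℕ.+ i)
          H-recurrence : ∀ i → H i ≈ ⟪ 1 ℕ.+ i ⟫ B′ i + A (1 ℕ.+ i)

  -- Abstract form of the passage from the functional equation to the recurrences: `σ` stands for
  -- the dilation, `τ i` for the weighting of coefficients, and the hypotheses are the rules for
  -- moving `τ` past products with `X` and `α` and past `σ`.
  module Twist
    (X α : Carrier) (v : ℕ → Carrier) (σ : Carrier → Carrier) (τ : ℕ → Carrier → Carrier)
    (τ-cong : ∀ i {f g} → f ≈ g → τ i f ≈ τ i g)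
    (τ-+ : ∀ i f g → τ i (f + g) ≈ τ i f + τ i g)
    (τ-X : ∀ i f → τ i (X * f) ≈ X * (v i * τ (1 ℕ.+ i) f))
    (τ-α : ∀ i f → τ i (α * f) ≈ X * (v (1 ℕ.+ i) * τ (1 ℕ.+ i) f))
    (τ-σ : ∀ i f → τ i (σ f) ≈ τ (1 ℕ.+ i) f)
    (Φ : Carrier)
    (equation : σ Φ + α * σ Φ + α * (α * σ Φ) + α * (α * (α * σ Φ)) + (α * X * Φ + α * (α * X) * Φ)
                  ≈ Φ + α * (α * X) * (α * X * Φ))
    where

    open Recurrences X v

    -- With b = 1 + i, the partitions that begin with b, b continue with an arbitrary member of
    -- `Partition≥ (2 + b)`; `H` removes them from `A`.
    A H : ℕ → Carrier
    A i = τ i Φ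
    H i = A i + - (⟪ 1 ℕ.+ i ⟫ ⟪ 1 ℕ.+ i ⟫ A (2 ℕ.+ i))

    H+rest : ∀ i → H i + ⟪ 1 ℕ.+ i ⟫ ⟪ 1 ℕ.+ i ⟫ A (2 ℕ.+ i) ≈ A i
    H+rest i = trans (+-assoc _ _ _) (trans (+-congˡ (-‿inverseˡ _)) (+-identityʳ _))

    τ-β : ∀ i f → τ i (α * X * f) ≈ ⟪ 1 ℕ.+ i ⟫ ⟪ 1 ℕ.+ i ⟫ τ (2 ℕ.+ i) f
    τ-β i f = begin
      τ i (α * X * f)                         ≈⟨ τ-cong i (*-assoc _ _ _) ⟩
      τ i (α * (X * f))                       ≈⟨ τ-α i (X * f) ⟩
      ⟪ 1 ℕ.+ i ⟫ τ (1 ℕ.+ i) (X * f)         ≈⟨ ⟪⟫-cong (1 ℕ.+ i) (τ-X (1 ℕ.+ i) f) ⟩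
      ⟪ 1 ℕ.+ i ⟫ ⟪ 1 ℕ.+ i ⟫ τ (2 ℕ.+ i) f   ∎

    τ-γ : ∀ i f → τ i (α * (α * X) * f) ≈ ⟪ 1 ℕ.+ i ⟫ ⟪ 2 ℕ.+ i ⟫ ⟪ 2 ℕ.+ i ⟫ τ (3 ℕ.+ i) f
    τ-γ i f = begin
      τ i (α * (α * X) * f)            ≈⟨ τ-cong i (*-assoc _ _ _) ⟩
      τ i (α * (α * X * f))            ≈⟨ τ-α i (α * X * f) ⟩
      ⟪ 1 ℕ.+ i ⟫ τ (1 ℕ.+ i) (α * X * f)
        ≈⟨ ⟪⟫-cong (1 ℕ.+ i) (τ-β (1 ℕ.+ i) f) ⟩
      ⟪ 1 ℕ.+ i ⟫ ⟪ 2 ℕ.+ i ⟫ ⟪ 2 ℕ.+ i ⟫ τ (3 ℕ.+ i) f ∎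

    -- The image of `equation` under `τ i`. Each factor `X` or `α` turns into `X` times some `v j`
    -- and raises the index of `τ` by one, and so does `σ`.
    twisted : ∀ i →
      A (1 ℕ.+ i) + ⟪ 1 ℕ.+ i ⟫ A (2 ℕ.+ i) + ⟪ 1 ℕ.+ i ⟫ ⟪ 2 ℕ.+ i ⟫ A (3 ℕ.+ i)
        + ⟪ 1 ℕ.+ i ⟫ ⟪ 2 ℕ.+ i ⟫ ⟪ 3 ℕ.+ i ⟫ A (4 ℕ.+ i)
        + (⟪ 1 ℕ.+ i ⟫ ⟪ 1 ℕ.+ i ⟫ A (2 ℕ.+ i) + ⟪ 1 ℕ.+ i ⟫ ⟪ 2 ℕ.+ i ⟫ ⟪ 2 ℕ.+ i ⟫ A (3 ℕ.+ i))
      ≈ A i + ⟪ 1 ℕ.+ i ⟫ ⟪ 2 ℕ.+ i ⟫ ⟪ 2 ℕ.+ i ⟫ ⟪ 4 ℕ.+ i ⟫ ⟪ 4 ℕ.+ i ⟫ A (5 ℕ.+ i)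
    twisted i = begin
      _ ≈⟨ +-cong (+-cong (+-cong (+-cong (τ-σ i Φ) (τ-ασ i)) (τ-αασ i)) τ-αααs)
                  (+-cong (τ-β i Φ) (τ-γ i Φ)) ⟨
      τ i s + τ i (α * s) + τ i (α * (α * s)) + τ i (α * (α * (α * s))) + (τ i (β * Φ) + τ i (γ * Φ))
        ≈⟨ +-cong (+-congʳ (+-congʳ (τ-+ i _ _))) (τ-+ i _ _) ⟨
      τ i (s + α * s) + τ i (α * (α * s)) + τ i (α * (α * (α * s))) + τ i (β * Φ + γ * Φ)
        ≈⟨ +-congʳ (+-congʳ (τ-+ i _ _)) ⟨
      τ i (s + α * s + α * (α * s)) + τ i (α * (α * (α * s))) + τ i (β * Φ + γ * Φ)
        ≈⟨ +-congʳ (τ-+ i _ _) ⟨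
      τ i (s + α * s + α * (α * s) + α * (α * (α * s))) + τ i (β * Φ + γ * Φ)
        ≈⟨ τ-+ i _ _ ⟨
      τ i (s + α * s + α * (α * s) + α * (α * (α * s)) + (β * Φ + γ * Φ))
        ≈⟨ τ-cong i equation ⟩
      τ i (Φ + γ * (β * Φ))
        ≈⟨ τ-+ i _ _ ⟩
      τ i Φ + τ i (γ * (β * Φ))
        ≈⟨ +-congˡ (trans (τ-γ i (β * Φ)) (⟪⟫-cong _ (⟪⟫-cong _ (⟪⟫-cong _ (τ-β (3 ℕ.+ i) Φ))))) ⟩
      _ ∎
      where
      s β γ : Carrier
      s = σ Φ
      β = α * X
      γ = α * (α * X)

      τ-ασ : ∀ i → τ i (α * s) ≈ ⟪ 1 ℕ.+ i ⟫ A (2 ℕ.+ i)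
      τ-ασ i = trans (τ-α i s) (⟪⟫-cong _ (τ-σ _ Φ))

      τ-αασ : ∀ i → τ i (α * (α * s)) ≈ ⟪ 1 ℕ.+ i ⟫ ⟪ 2 ℕ.+ i ⟫ A (3 ℕ.+ i)
      τ-αασ i = trans (τ-α i (α * s)) (⟪⟫-cong _ (τ-ασ _))

      τ-αααs : τ i (α * (α * (α * s))) ≈ ⟪ 1 ℕ.+ i ⟫ ⟪ 2 ℕ.+ i ⟫ ⟪ 3 ℕ.+ i ⟫ A (4 ℕ.+ i)
      τ-αααs = trans (τ-α i (α * (α * s))) (⟪⟫-cong _ (τ-αασ _))

    A-recurrence : ∀ i →
      A i ≈ ⟪ 1 ℕ.+ i ⟫ (⟪ 1 ℕ.+ i ⟫ A (2 ℕ.+ i) + B′ A H i) + A (1 ℕ.+ i)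
    -- Since A (3 + i) = H (3 + i) + w, the last term on the left of `twisted` contains the extra
    -- term on its right. Cancelling it leaves a recurrence with no negative term.
    A-recurrence i = ∙-cancelʳ (⟪ 1 ℕ.+ i ⟫ ⟪ 2 ℕ.+ i ⟫ ⟪ 2 ℕ.+ i ⟫ w) _ _ (begin
      A i + ⟪ 1 ℕ.+ i ⟫ ⟪ 2 ℕ.+ i ⟫ ⟪ 2 ℕ.+ i ⟫ w ≈⟨ twisted i ⟨
      _ + (_ + ⟪ 1 ℕ.+ i ⟫ ⟪ 2 ℕ.+ i ⟫ ⟪ 2 ℕ.+ i ⟫ A (3 ℕ.+ i))
        ≈⟨ +-congˡ (+-congˡ (⟪⟫-cong (1 ℕ.+ i) (⟪⟫-cong (2 ℕ.+ i) (⟪⟫-cong (2 ℕ.+ i) (H+rest (3 ℕ.+ i)))))) ⟨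
      _ ≈⟨ solve 10 (λ x v₁ v₂ v₃ a₁ a₂ a₃ a₄ h₃ w →
             a₁ :+ x :* (v₁ :* a₂) :+ x :* (v₁ :* (x :* (v₂ :* a₃)))
               :+ x :* (v₁ :* (x :* (v₂ :* (x :* (v₃ :* a₄)))))
               :+ (x :* (v₁ :* (x :* (v₁ :* a₂)))
                    :+ x :* (v₁ :* (x :* (v₂ :* (x :* (v₂ :* (h₃ :+ w)))))))
             := x :* (v₁ :* (x :* (v₁ :* a₂)
                   :+ (x :* (v₂ :* (x :* (v₂ :* h₃) :+ (x :* (v₃ :* a₄) :+ a₃))) :+ a₂)))
                  :+ a₁ :+ x :* (v₁ :* (x :* (v₂ :* (x :* (v₂ :* w))))))
           refl X (v (1 ℕ.+ i)) (v (2 ℕ.+ i)) (v (3 ℕ.+ i)) (A (1 ℕ.+ i)) (A (2 ℕ.+ i))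
           (A (3 ℕ.+ i)) (A (4 ℕ.+ i)) (H (3 ℕ.+ i)) w ⟩
      ⟪ 1 ℕ.+ i ⟫ (⟪ 1 ℕ.+ i ⟫ A (2 ℕ.+ i) + B′ A H i) + A (1 ℕ.+ i)
        + ⟪ 1 ℕ.+ i ⟫ ⟪ 2 ℕ.+ i ⟫ ⟪ 2 ℕ.+ i ⟫ w ∎)
      where
      w : Carrier
      w = ⟪ 4 ℕ.+ i ⟫ ⟪ 4 ℕ.+ i ⟫ A (5 ℕ.+ i)

    H-recurrence : ∀ i → H i ≈ ⟪ 1 ℕ.+ i ⟫ B′ A H i + A (1 ℕ.+ i)
    H-recurrence i = ∙-cancelʳ (⟪ 1 ℕ.+ i ⟫ ⟪ 1 ℕ.+ i ⟫ A (2 ℕ.+ i)) _ _ (begin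
      H i + ⟪ 1 ℕ.+ i ⟫ ⟪ 1 ℕ.+ i ⟫ A (2 ℕ.+ i)  ≈⟨ H+rest i ⟩
      A i                                        ≈⟨ A-recurrence i ⟩
      ⟪ 1 ℕ.+ i ⟫ (⟪ 1 ℕ.+ i ⟫ A (2 ℕ.+ i) + B′ A H i) + A (1 ℕ.+ i)
        ≈⟨ solve 5 (λ x v₁ a₁ a₂ b → x :* (v₁ :* (x :* (v₁ :* a₂) :+ b)) :+ a₁
             := x :* (v₁ :* b) :+ a₁ :+ x :* (v₁ :* (x :* (v₁ :* a₂))))
           refl X (v (1 ℕ.+ i)) (A (1 ℕ.+ i)) (A (2 ℕ.+ i)) (B′ A H i) ⟩
      ⟪ 1 ℕ.+ i ⟫ B′ A H i + A (1 ℕ.+ i) + ⟪ 1 ℕ.+ i ⟫ ⟪ 1 ℕ.+ i ⟫ A (2 ℕ.+ i) ∎)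

    solution : Solution A H
    solution = record { A-recurrence = A-recurrence ; H-recurrence = H-recurrence }

-- Enumerations by duplicate-free lists

open ≡ using (refl)

record Enumerates {I : Set} (P : Pred I 0ℓ) (L : List I) : Set where
  field
    unique   : Unique L
    sound    : ∀ {i} → i ∈ L → P i
    complete : ∀ {i} → P i → i ∈ L

open Enumerates

Enumerates-≐ : ∀ {I : Set} {P Q : Pred I 0ℓ} {L} → P ≐ Q → Enumerates P L → Enumerates Q L
Enumerates-≐ (P⊆Q , Q⊆P) e = record
  { unique = unique e ; sound = λ i∈ → P⊆Q (sound e i∈) ; complete = λ qi → complete e (Q⊆P qi) }

Enumerates-∪ : ∀ {I : Set} {P Q : Pred I 0ℓ} {L L′} → (∀ {i} → P i → ¬ Q i) →
  Enumerates P L → Enumerates Q L′ → Enumerates (P ∪ Q) (L ++ L′)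
Enumerates-∪ {L = L} {L′} disjoint e e′ = record
  { unique   = Uniqueₚ.++⁺ (unique e) (unique e′) λ (i∈ , i∈′) → disjoint (sound e i∈) (sound e′ i∈′)
  ; sound    = λ i∈ → snd (∈-++⁻ L i∈)
  ; complete = λ where
      (inj₁ p) → ∈-++⁺ˡ (complete e p)
      (inj₂ q) → ∈-++⁺ʳ L (complete e′ q)
  }
  where
  snd : ∀ {i} → i ∈ L ⊎ i ∈ L′ → _
  snd (inj₁ i∈) = inj₁ (sound e i∈)
  snd (inj₂ i∈) = inj₂ (sound e′ i∈)

-- The indices that contribute to the coefficient of X^t in a series in X^s, at most one. The same
-- lists define `spread` and build the lists of quadruples.
quotients : ℕ → ℕ → List ℕ
quotients s t with s ∣? t
... | yes (divides k _) = k ∷ []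
... | no  _             = []

quotients-enumerate : ∀ s .{{_ : ℕ.NonZero s}} t → Enumerates (λ i → i ℕ.* s ≡ t) (quotients s t)
quotients-enumerate s t with s ∣? t
... | yes (divides k refl) = record
  { unique   = [] ∷ []
  ; sound    = λ where (here refl) → refl
  ; complete = λ {i} eq → here (ℕₚ.*-cancelʳ-≡ i k s eq)
  }
... | no s∤t = record
  { unique   = []
  ; sound    = λ ()
  ; complete = λ {i} eq → contradiction (divides i (≡.sym eq)) s∤t
  }

-- Arranged like the Cauchy product, so that a sum over these pairs is a coefficient of a product of
-- two series.
convolve : {I J : Set} → (ℕ → List I) → (ℕ → List J) → ℕ → List (I × J)
convolve L L′ m = concat (applyUpTo (λ t → cartesianProduct (L t) (L′ (m ∸ t))) (suc m))

convolve-enumerates : ∀ {I J : Set} {w : I → ℕ} {w′ : J → ℕ} {L L′} →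
  (∀ t → Enumerates (λ i → w i ≡ t) (L t)) → (∀ t → Enumerates (λ j → w′ j ≡ t) (L′ t)) →
  ∀ m → Enumerates (λ (i , j) → w i ℕ.+ w′ j ≡ m) (convolve L L′ m)
convolve-enumerates {w = w} {w′} {L} {L′} e e′ m = record
  { unique   = Uniqueₚ.concat⁺
      (Allₚ.applyUpTo⁺₂ block (suc m) (λ t → Uniqueₚ.cartesianProduct⁺ (E.unique t) (E′.unique (m ∸ t))))
      (AllPairsₚ.applyUpTo⁺₁ block (suc m) disjoint)
  ; sound    = sound′
  ; complete = complete′
  }
  where
  module E t = Enumerates (e t)
  module E′ t = Enumerates (e′ t)

  block : ℕ → List _
  block t = cartesianProduct (L t) (L′ (m ∸ t))

  -- The weight of the first entry determines the block in which a pair lies.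
  disjoint : ∀ {s t} → s < t → t < suc m → ∀ {ij} → ¬ (ij ∈ block s × ij ∈ block t)
  disjoint {s} {t} s<t _ (∈s , ∈t) = ℕₚ.<⇒≢ s<t (≡.trans
    (≡.sym (E.sound s (proj₁ (∈-cartesianProduct⁻ (L s) (L′ (m ∸ s)) ∈s))))
    (E.sound t (proj₁ (∈-cartesianProduct⁻ (L t) (L′ (m ∸ t)) ∈t))))

  sound′ : ∀ {ij} → ij ∈ convolve L L′ m → w (proj₁ ij) ℕ.+ w′ (proj₂ ij) ≡ m
  sound′ ij∈ with ∈-concat⁻′ (applyUpTo block (suc m)) ij∈
  ... | _ , ij∈b , b∈ with ∈-applyUpTo⁻ block b∈
  ...   | t , s≤s t≤m , refl with ∈-cartesianProduct⁻ (L t) (L′ (m ∸ t)) ij∈b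
  ...     | i∈ , j∈ = ≡.trans (≡.cong₂ ℕ._+_ (E.sound t i∈) (E′.sound (m ∸ t) j∈)) (ℕₚ.m+[n∸m]≡n t≤m)

  complete′ : ∀ {ij} → w (proj₁ ij) ℕ.+ w′ (proj₂ ij) ≡ m → ij ∈ convolve L L′ m
  complete′ {i , j} refl = ∈-concat⁺′
    (∈-cartesianProduct⁺ (E.complete (w i) refl) (E′.complete _ (≡.sym (ℕₚ.m+n∸m≡n (w i) (w′ j)))))
    (∈-applyUpTo⁺ block (s≤s (ℕₚ.m≤m+n (w i) (w′ j))))

-- Sums over lists of indices

module FiniteSum {c ℓ : Level} (R : CommutativeRing c ℓ) where
  open CommutativeRing R renaming (refl to ≈-refl)
  open PowerSeries R
  open import Relation.Binary.Reasoning.Setoid setoid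

  sum : List Carrier → Carrier
  sum = foldr _+_ 0#

  Σ⟨_⟩ : {I : Set} → List I → (I → Carrier) → Carrier
  Σ⟨ L ⟩ F = sum (map F L)

  sum-++ : ∀ xs ys → sum (xs ++ ys) ≈ sum xs + sum ys
  sum-++ []       ys = sym (+-identityˡ _)
  sum-++ (x ∷ xs) ys = trans (+-congˡ (sum-++ xs ys)) (sym (+-assoc _ _ _))

  Σ-++ : {I : Set} (F : I → Carrier) → ∀ L L′ → Σ⟨ L ++ L′ ⟩ F ≈ Σ⟨ L ⟩ F + Σ⟨ L′ ⟩ F
  Σ-++ F L L′ = trans (reflexive (≡.cong sum (Listₚ.map-++ F L L′))) (sum-++ (map F L) (map F L′))

  Σ-cong : {I : Set} {F G : I → Carrier} → ∀ L → (∀ {i} → i ∈ L → F i ≈ G i) → Σ⟨ L ⟩ F ≈ Σ⟨ L ⟩ G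
  Σ-cong []      h = ≈-refl
  Σ-cong (i ∷ L) h = +-cong (h (here refl)) (Σ-cong L (λ i∈ → h (there i∈)))

  Σ-*ˡ : {I : Set} (F : I → Carrier) → ∀ a L → Σ⟨ L ⟩ (λ i → a * F i) ≈ a * Σ⟨ L ⟩ F
  Σ-*ˡ F a []      = sym (zeroʳ a)
  Σ-*ˡ F a (i ∷ L) = trans (+-congˡ (Σ-*ˡ F a L)) (sym (distribˡ _ _ _))

  Σ-cartesianProduct : {I J : Set} (F : I → Carrier) (G : J → Carrier) → ∀ L L′ →
    Σ⟨ cartesianProduct L L′ ⟩ (λ (i , j) → F i * G j) ≈ Σ⟨ L ⟩ F * Σ⟨ L′ ⟩ G
  Σ-cartesianProduct F G []      L′ = sym (zeroˡ _)
  Σ-cartesianProduct F G (i ∷ L) L′ = begin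
    Σ⟨ map (i ,_) L′ ++ cartesianProduct L L′ ⟩ FG  ≈⟨ Σ-++ FG (map (i ,_) L′) _ ⟩
    Σ⟨ map (i ,_) L′ ⟩ FG + Σ⟨ cartesianProduct L L′ ⟩ FG
      ≈⟨ +-cong (trans (reflexive (≡.cong sum (≡.sym (Listₚ.map-∘ L′)))) (Σ-*ˡ G (F i) L′))
                (Σ-cartesianProduct F G L L′) ⟩
    F i * Σ⟨ L′ ⟩ G + Σ⟨ L ⟩ F * Σ⟨ L′ ⟩ G          ≈⟨ distribʳ _ _ _ ⟨
    (F i + Σ⟨ L ⟩ F) * Σ⟨ L′ ⟩ G                    ∎
    where FG = λ (i , j) → F i * G j

  Σ-concat : {I : Set} (F : I → Carrier) → ∀ (g : ℕ → List I) n →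
    Σ⟨ concat (applyUpTo g n) ⟩ F ≈ sum (applyUpTo (λ k → Σ⟨ g k ⟩ F) n)
  Σ-concat F g zero    = ≈-refl
  Σ-concat F g (suc n) = trans (Σ-++ F (g 0) _) (+-congˡ (Σ-concat F (λ k → g (suc k)) n))

  sum-applyUpTo-cong : ∀ {f g : ℕ → Carrier} n → (∀ k → f k ≈ g k) →
    sum (applyUpTo f n) ≈ sum (applyUpTo g n)
  sum-applyUpTo-cong zero    h = ≈-refl
  sum-applyUpTo-cong (suc n) h = +-cong (h 0) (sum-applyUpTo-cong n (λ k → h (suc k)))

  Σ-convolve : {I J : Set} (F : I → Carrier) (G : J → Carrier) → ∀ L L′ →
    (λ m → Σ⟨ convolve L L′ m ⟩ (λ (i , j) → F i * G j))
      ≋ (λ t → Σ⟨ L t ⟩ F) ⊗ (λ t → Σ⟨ L′ t ⟩ G)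
  Σ-convolve F G L L′ m = begin
    Σ⟨ convolve L L′ m ⟩ FG
      ≈⟨ Σ-concat FG (λ t → cartesianProduct (L t) (L′ (m ∸ t))) (suc m) ⟩
    sum (applyUpTo (λ t → Σ⟨ cartesianProduct (L t) (L′ (m ∸ t)) ⟩ FG) (suc m))
      ≈⟨ sum-applyUpTo-cong (suc m) (λ t → Σ-cartesianProduct F G (L t) (L′ (m ∸ t))) ⟩
    sum (applyUpTo (λ t → Σ⟨ L t ⟩ F * Σ⟨ L′ (m ∸ t) ⟩ G) (suc m))
      ≈⟨ ⊗-applyUpTo (λ t → Σ⟨ L t ⟩ F) (λ t → Σ⟨ L′ t ⟩ G) m ⟨
    ((λ t → Σ⟨ L t ⟩ F) ⊗ (λ t → Σ⟨ L′ t ⟩ G)) m ∎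
    where FG = λ (i , j) → F i * G j

  Σ-convolve₄ : {I J K L : Set} (F₁ : I → Carrier) (F₂ : J → Carrier) (F₃ : K → Carrier) (F₄ : L → Carrier) →
    ∀ L₁ L₂ L₃ L₄ →
    (λ m → Σ⟨ convolve L₁ (convolve L₂ (convolve L₃ L₄)) m ⟩
             (λ (i , j , k , l) → F₁ i * (F₂ j * (F₃ k * F₄ l))))
      ≋ (λ t → Σ⟨ L₁ t ⟩ F₁) ⊗ ((λ t → Σ⟨ L₂ t ⟩ F₂) ⊗ ((λ t → Σ⟨ L₃ t ⟩ F₃) ⊗ (λ t → Σ⟨ L₄ t ⟩ F₄)))
  Σ-convolve₄ F₁ F₂ F₃ F₄ L₁ L₂ L₃ L₄ m = trans
    (Σ-convolve F₁ (λ (j , k , l) → F₂ j * (F₃ k * F₄ l)) L₁ (convolve L₂ (convolve L₃ L₄)) m)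
    (⊗-cong {λ t → Σ⟨ L₁ t ⟩ F₁} (λ _ → ≈-refl) (λ t → trans
      (Σ-convolve F₂ (λ (k , l) → F₃ k * F₄ l) L₂ (convolve L₃ L₄) t)
      (⊗-cong {λ t → Σ⟨ L₂ t ⟩ F₂} (λ _ → ≈-refl) (Σ-convolve F₃ F₄ L₃ L₄) t)) m)

-- The dilation X ↦ p X

-- The number n(n-1)/2, defined without division.
triangle : ℕ → ℕ
triangle zero    = 0
triangle (suc n) = n ℕ.+ triangle n

module Dilation {c ℓ : Level} (R : CommutativeRing c ℓ) (p : CommutativeRing.Carrier R) where
  open CommutativeRing R renaming (refl to ≈-refl)
  open PowerSeries R
  open FiniteSum R using (Σ⟨_⟩)
  open Exp semiring using (_^_; ^-homo-*; ^-congʳ)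
  open import Relation.Binary.Reasoning.Setoid setoid
  module 𝕊 = CommutativeRing seriesRing
  module Eˢ = Exp 𝕊.semiring
  open RingSolver commutativeSemiring

  σ : Series → Series
  σ f n = p ^ n * f n

  σ-⊗ : ∀ f g → σ (f ⊗ g) ≋ σ f ⊗ σ g
  σ-⊗ f g zero    = solve 2 (λ a b → con 1 :* (a :* b) := con 1 :* a :* (con 1 :* b)) ≈-refl (f 0) (g 0)
  σ-⊗ f g (suc n) = begin
    p * p ^ n * (f 0 * g (suc n) + (tail f ⊗ g) n)
      ≈⟨ solve 5 (λ p u a b c → p :* u :* (a :* b :+ c)
           := con 1 :* a :* (p :* u :* b) :+ p :* (u :* c))
         ≈-refl p (p ^ n) (f 0) (g (suc n)) _ ⟩
    1# * f 0 * (p * p ^ n * g (suc n)) + p * (p ^ n * (tail f ⊗ g) n)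
      ≈⟨ +-congˡ (*-congˡ (σ-⊗ (tail f) g n)) ⟩
    1# * f 0 * (p * p ^ n * g (suc n)) + p * (σ (tail f) ⊗ σ g) n
      ≈⟨ +-congˡ (⊙-⊗ p (σ (tail f)) (σ g) n) ⟨
    1# * f 0 * (p * p ^ n * g (suc n)) + ((p ⊙ σ (tail f)) ⊗ σ g) n
      ≈⟨ +-congˡ (⊗-cong (λ i → *-assoc p (p ^ i) (f (suc i))) (λ _ → ≈-refl) n) ⟨
    (σ f ⊗ σ g) (suc n) ∎

  -- The weighting by q^{m(m-1)/2 + (b-1)m} for p = q and i = b - 1. It is multiplicative in no
  -- sense, but shifting or dilating its argument only raises `i` by one.
  τ : ℕ → Series → Series
  τ i f n = p ^ (triangle n ℕ.+ i ℕ.* n) * f n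

  v : ℕ → Series
  v i = const (p ^ i)

  α : Series
  α = const p ⊗ X

  τ-cong : ∀ i {f g} → f ≋ g → τ i f ≋ τ i g
  τ-cong i f≋g n = *-congˡ (f≋g n)

  τ-+ : ∀ i f g → τ i (f 𝕊.+ g) ≋ τ i f 𝕊.+ τ i g
  τ-+ i f g n = distribˡ _ _ _

  τ-const : ∀ i c f → τ i (const c ⊗ f) ≋ const c ⊗ τ i f
  τ-const i c f n = begin
    u * (const c ⊗ f) n  ≈⟨ *-congˡ (const⊗ c f n) ⟩
    u * (c * f n)        ≈⟨ solve 3 (λ a b c → a :* (b :* c) := b :* (a :* c)) ≈-refl u c (f n) ⟩
    c * τ i f n          ≈⟨ const⊗ c (τ i f) n ⟨
    (const c ⊗ τ i f) n  ∎
    where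
    u : Carrier
    u = p ^ (triangle n ℕ.+ i ℕ.* n)

  -- The weight of index n + 1 at level i is p^i times the weight of index n at level i + 1.
  τ-X : ∀ i f → τ i (X ⊗ f) ≋ X ⊗ (v i ⊗ τ (suc i) f)
  τ-X i f zero    = trans (*-congˡ (X⊗-zero f)) (trans (zeroʳ _) (sym (X⊗-zero (v i ⊗ τ (suc i) f))))
  τ-X i f (suc n) = begin
    p ^ (n ℕ.+ triangle n ℕ.+ i ℕ.* suc n) * (X ⊗ f) (suc n)
      ≈⟨ *-cong (^-congʳ p exponent) (X⊗-suc f n) ⟩
    p ^ (i ℕ.+ (triangle n ℕ.+ suc i ℕ.* n)) * f n
      ≈⟨ *-congʳ (^-homo-* p i _) ⟩
    p ^ i * p ^ (triangle n ℕ.+ suc i ℕ.* n) * f n  ≈⟨ *-assoc _ _ _ ⟩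
    p ^ i * τ (suc i) f n                           ≈⟨ const⊗ (p ^ i) (τ (suc i) f) n ⟨
    (v i ⊗ τ (suc i) f) n                           ≈⟨ X⊗-suc (v i ⊗ τ (suc i) f) n ⟨
    (X ⊗ (v i ⊗ τ (suc i) f)) (suc n)               ∎
    where
    exponent : n ℕ.+ triangle n ℕ.+ i ℕ.* suc n ≡ i ℕ.+ (triangle n ℕ.+ suc i ℕ.* n)
    exponent = +-*-Solver.solve 3
      (λ n t i → n N:+ t N:+ i N:* (N.con 1 N:+ n) N:= i N:+ (t N:+ (N.con 1 N:+ i) N:* n))
      refl n (triangle n) i
      where
      module N = +-*-Solver
      open N using () renaming (_:+_ to _N:+_; _:*_ to _N:*_; _:=_ to _N:=_)

  τ-α : ∀ i f → τ i (α ⊗ f) ≋ X ⊗ (v (suc i) ⊗ τ (suc i) f)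
  τ-α i f = 𝕊.trans (τ-cong i (𝕊.*-assoc (const p) X f)) (𝕊.trans (τ-const i p (X ⊗ f))
    (𝕊.trans (𝕊.*-congˡ {const p} (τ-X i f))
    (𝕊.trans (rearrange (const p) X (v i) (τ (suc i) f))
             (𝕊.*-congˡ {X} (𝕊.*-congʳ {τ (suc i) f} (𝕊.sym (const-* p (p ^ i))))))))
    where
    open RingSolver 𝕊.commutativeSemiring renaming (solve to solveˢ; _:*_ to _:⊗_; _:=_ to _:≋_)
    rearrange : ∀ a b c d → a ⊗ (b ⊗ (c ⊗ d)) ≋ b ⊗ (a ⊗ c ⊗ d)
    rearrange = solveˢ 4 (λ a b c d → a :⊗ (b :⊗ (c :⊗ d)) :≋ b :⊗ (a :⊗ c :⊗ d)) 𝕊.refl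

  τ-σ : ∀ i f → τ i (σ f) ≋ τ (suc i) f
  τ-σ i f n = begin
    p ^ (triangle n ℕ.+ i ℕ.* n) * (p ^ n * f n)  ≈⟨ *-assoc _ _ _ ⟨
    p ^ (triangle n ℕ.+ i ℕ.* n) * p ^ n * f n    ≈⟨ *-congʳ (^-homo-* p (triangle n ℕ.+ i ℕ.* n) n) ⟨
    p ^ (triangle n ℕ.+ i ℕ.* n ℕ.+ n) * f n
      ≈⟨ *-congʳ (^-congʳ p (≡.trans (ℕₚ.+-assoc (triangle n) _ n)
           (≡.cong (triangle n ℕ.+_) (ℕₚ.+-comm (i ℕ.* n) n)))) ⟩
    τ (suc i) f n                                 ∎

  -- e(Xˢ)
  spread : ℕ → (ℕ → Carrier) → Series
  spread s e t = Σ⟨ quotients s t ⟩ e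

  spread-* : ∀ s .{{_ : ℕ.NonZero s}} e k → spread s e (k ℕ.* s) ≈ e k
  spread-* s e k with s ∣? (k ℕ.* s)
  ... | yes (divides k′ eq) rewrite ℕₚ.*-cancelʳ-≡ k k′ s eq = +-identityʳ _
  ... | no  s∤              = contradiction (divides k refl) s∤

  spread-∤ : ∀ s e {t} → ¬ s ∣ t → spread s e t ≈ 0#
  spread-∤ s e {t} s∤t with s ∣? t
  ... | yes s∣t = contradiction s∣t s∤t
  ... | no  _   = ≈-refl

  open Eˢ using () renaming (_^_ to _^ᵖ_)

  X^⊗-< : ∀ s f {t} → t ℕ.< s → (X ^ᵖ s ⊗ f) t ≈ 0#
  X^⊗-< (suc s) f {zero}  _           = trans (𝕊.*-assoc X (X ^ᵖ s) f 0) (X⊗-zero (X ^ᵖ s ⊗ f))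
  X^⊗-< (suc s) f {suc t} (ℕ.s≤s t<s) =
    trans (𝕊.*-assoc X (X ^ᵖ s) f (suc t)) (trans (X⊗-suc (X ^ᵖ s ⊗ f) t) (X^⊗-< s f t<s))

  X^⊗-+ : ∀ s f t → (X ^ᵖ s ⊗ f) (s ℕ.+ t) ≈ f t
  X^⊗-+ zero    f t = 1⊗ f t
  X^⊗-+ (suc s) f t =
    trans (𝕊.*-assoc X (X ^ᵖ s) f (suc (s ℕ.+ t))) (trans (X⊗-suc (X ^ᵖ s ⊗ f) (s ℕ.+ t)) (X^⊗-+ s f t))

  module _ (s : ℕ) .{{_ : ℕ.NonZero s}} {M : Series} {y : Carrier} (M≋ : M ≋ const y ⊗ X ^ᵖ s) where

    monomial⊗ : ∀ f t → (M ⊗ f) t ≈ y * (X ^ᵖ s ⊗ f) t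
    monomial⊗ f t = trans (⊗-cong {g = f} M≋ (λ _ → ≈-refl) t)
      (trans (𝕊.*-assoc (const y) (X ^ᵖ s) f t) (const⊗ y (X ^ᵖ s ⊗ f) t))

    monomial⊗-< : ∀ f {t} → t ℕ.< s → (M ⊗ f) t ≈ 0#
    monomial⊗-< f {t} t<s = trans (monomial⊗ f t) (trans (*-congˡ (X^⊗-< s f t<s)) (zeroʳ y))

    monomial⊗-+ : ∀ f t → (M ⊗ f) (s ℕ.+ t) ≈ y * f t
    monomial⊗-+ f t = trans (monomial⊗ f (s ℕ.+ t)) (*-congˡ (X^⊗-+ s f t))

    -- Turns a recurrence between coefficients into an equation between series in X^s, where `M` is
    -- the monomial y X^s; at exponents that `s` does not divide both sides vanish.
    spread-recurrence : ∀ e d f → e 0 ≈ d 0 → (∀ i → e (suc i) ≈ d (suc i) + y * f i) →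
      spread s e ≋ spread s d 𝕊.+ (M ⊗ spread s f)
    spread-recurrence e d f e₀ eₛ t with s ∣? t
    ... | yes (divides zero refl) = begin
      e 0 + 0#         ≈⟨ +-congʳ e₀ ⟩
      d 0 + 0#         ≈⟨ +-cong (+-identityʳ _) (monomial⊗-< (spread s f) (ℕ.>-nonZero⁻¹ s)) ⟨
      (d 0 + 0#) + (M ⊗ spread s f) 0 ∎
    ... | yes (divides (suc k) refl) = begin
      e (suc k) + 0#             ≈⟨ +-identityʳ _ ⟩
      e (suc k)                  ≈⟨ eₛ k ⟩
      d (suc k) + y * f k        ≈⟨ +-cong (+-identityʳ _) (*-congˡ (spread-* s f k)) ⟨
      (d (suc k) + 0#) + y * spread s f (k ℕ.* s)
                                 ≈⟨ +-congˡ (monomial⊗-+ (spread s f) (k ℕ.* s)) ⟨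
      (d (suc k) + 0#) + (M ⊗ spread s f) (suc k ℕ.* s) ∎
    ... | no s∤t = sym (trans (+-identityˡ _) shifted-zero)
      where
      shifted-zero : (M ⊗ spread s f) t ≈ 0#
      shifted-zero with ℕₚ.<-≤-connex t s
      ... | inj₁ t<s = monomial⊗-< (spread s f) t<s
      ... | inj₂ s≤t with ℕₚ.m≤n⇒∃[o]m+o≡n s≤t
      ...   | u , refl = trans (monomial⊗-+ (spread s f) u)
        (trans (*-congˡ (spread-∤ s f (λ s∣u → s∤t (∣m∣n⇒∣m+n ∣-refl s∣u)))) (zeroʳ y))

  σ-spread : ∀ s e → σ (spread s e) ≋ spread s (λ i → p ^ (i ℕ.* s) * e i)
  σ-spread s e t with s ∣? t
  ... | yes (divides k refl) = trans (distribˡ _ _ _) (+-congˡ (zeroʳ _))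
  ... | no  _                  = zeroʳ _

  -- The infinite products are never formed. The steps characterise Euler's coefficients of 1/(pX;
  -- p), 1/(pX²; p²), 1/(p²X³; p³) and (p⁴X⁴; p⁴) through their ratios, which is enough for the
  -- functional equation.
  module Product (e₁ e₂ e₃ e₄ : ℕ → Carrier)
    (step₁ : ∀ i → e₁ (suc i) ≈ p ^ (suc i ℕ.* 1) * e₁ (suc i) + p * e₁ i)
    (step₂ : ∀ i → e₂ (suc i) ≈ p ^ (suc i ℕ.* 2) * e₂ (suc i) + p * e₂ i)
    (step₃ : ∀ i → e₃ (suc i) ≈ p ^ (suc i ℕ.* 3) * e₃ (suc i) + p * p * e₃ i)
    (step₄ : ∀ i → p ^ (suc i ℕ.* 4) * e₄ (suc i)
                     ≈ e₄ (suc i) + p * (p * (p * p)) * (p ^ (i ℕ.* 4) * e₄ i))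
    where

    Φ : Series
    Φ = spread 1 e₁ ⊗ (spread 2 e₂ ⊗ (spread 3 e₃ ⊗ spread 4 e₄))

    private
      module Sol = RingSolver 𝕊.commutativeSemiring
      open Sol using () renaming (solve to solveˢ; _:*_ to _:⊗_; _:=_ to _:≋_; con to conˢ)

      dilate : ℕ → (ℕ → Carrier) → ℕ → Carrier
      dilate s e i = p ^ (i ℕ.* s) * e i

      1*-inv : ∀ {a} → a ≈ 1# * a
      1*-inv = sym (*-identityˡ _)

      unfold : ∀ s .{{_ : ℕ.NonZero s}} {M y} e → M ≋ const y ⊗ X ^ᵖ s →
        (∀ i → e (suc i) ≈ p ^ (suc i ℕ.* s) * e (suc i) + y * e i) →
        spread s e ≋ σ (spread s e) 𝕊.+ (M ⊗ spread s e)
      unfold s {M} e M≋ step = 𝕊.trans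
        (spread-recurrence s M≋ e (dilate s e) e 1*-inv step)
        (𝕊.+-congʳ {M ⊗ spread s e} (𝕊.sym (σ-spread s e)))

      monomial₁ : α ≋ const p ⊗ X ^ᵖ 1
      monomial₁ = solveˢ 2 (λ a x → a :⊗ x :≋ a :⊗ (x :⊗ conˢ 1)) 𝕊.refl (const p) X

      monomial₂ : α ⊗ X ≋ const p ⊗ X ^ᵖ 2
      monomial₂ = solveˢ 2 (λ a x → a :⊗ x :⊗ x :≋ a :⊗ (x :⊗ (x :⊗ conˢ 1))) 𝕊.refl (const p) X

      monomial₃ : α ⊗ (α ⊗ X) ≋ const (p * p) ⊗ X ^ᵖ 3
      monomial₃ = 𝕊.trans
        (solveˢ 2 (λ a x → a :⊗ x :⊗ (a :⊗ x :⊗ x) :≋ a :⊗ a :⊗ (x :⊗ (x :⊗ (x :⊗ conˢ 1))))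
          𝕊.refl (const p) X)
        (𝕊.*-congʳ {X ^ᵖ 3} (𝕊.sym (const-* p p)))

      monomial₄ : α ⊗ (α ⊗ (α ⊗ α)) ≋ const (p * (p * (p * p))) ⊗ X ^ᵖ 4
      monomial₄ = 𝕊.trans
        (solveˢ 2 (λ a x → a :⊗ x :⊗ (a :⊗ x :⊗ (a :⊗ x :⊗ (a :⊗ x)))
           :≋ a :⊗ (a :⊗ (a :⊗ a)) :⊗ (x :⊗ (x :⊗ (x :⊗ (x :⊗ conˢ 1))))) 𝕊.refl (const p) X)
        (𝕊.*-congʳ {X ^ᵖ 4} (𝕊.sym (𝕊.trans (const-* p (p * (p * p)))
          (𝕊.*-congˡ {const p} (𝕊.trans (const-* p (p * p)) (𝕊.*-congˡ {const p} (const-* p p)))))))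

      -- Dilation removes the first factor 1 - α⁴ of the product (p⁴X⁴; p⁴). On coefficients this is
      -- `step₄`, in which the dilated sequence occurs on both sides.
      factor₄ : spread 4 e₄ 𝕊.+ (α ⊗ (α ⊗ (α ⊗ (α ⊗ σ (spread 4 e₄))))) ≋ σ (spread 4 e₄)
      factor₄ = 𝕊.sym (𝕊.trans (σ-spread 4 e₄) (𝕊.trans
        (spread-recurrence 4 monomial₄ (dilate 4 e₄) e₄ (dilate 4 e₄) (*-identityˡ _) step₄)
        (𝕊.+-congˡ {spread 4 e₄} (𝕊.trans
          (solveˢ 2 (λ a f → a :⊗ (a :⊗ (a :⊗ a)) :⊗ f :≋ a :⊗ (a :⊗ (a :⊗ (a :⊗ f)))) 𝕊.refl
            α (spread 4 (dilate 4 e₄)))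
          (αααα-cong (𝕊.sym (σ-spread 4 e₄)))))))
        where
        αααα-cong : ∀ {f g} → f ≋ g → α ⊗ (α ⊗ (α ⊗ (α ⊗ f))) ≋ α ⊗ (α ⊗ (α ⊗ (α ⊗ g)))
        αααα-cong f≋g = 𝕊.*-congˡ {α} (𝕊.*-congˡ {α} (𝕊.*-congˡ {α} (𝕊.*-congˡ {α} f≋g)))

      σΦ : σ Φ ≋ σ (spread 1 e₁) ⊗ (σ (spread 2 e₂) ⊗ (σ (spread 3 e₃) ⊗ σ (spread 4 e₄)))
      σΦ = 𝕊.trans (σ-⊗ _ _) (𝕊.*-congˡ {σ (spread 1 e₁)} (𝕊.trans (σ-⊗ _ _)
        (𝕊.*-congˡ {σ (spread 2 e₂)} (σ-⊗ _ _))))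

    equation : let β = α ⊗ X
                   γ = α ⊗ (α ⊗ X)
                   s = σ Φ
      in s 𝕊.+ (α ⊗ s) 𝕊.+ (α ⊗ (α ⊗ s)) 𝕊.+ (α ⊗ (α ⊗ (α ⊗ s))) 𝕊.+ ((β ⊗ Φ) 𝕊.+ (γ ⊗ Φ))
        ≋ Φ 𝕊.+ (γ ⊗ (β ⊗ Φ))
    equation = 𝕊.trans
      (𝕊.+-congʳ {(α ⊗ X ⊗ Φ) 𝕊.+ (α ⊗ (α ⊗ X) ⊗ Φ)}
        (𝕊.+-cong (𝕊.+-cong (𝕊.+-cong σΦ (𝕊.*-congˡ {α} σΦ)) (𝕊.*-congˡ {α} (𝕊.*-congˡ {α} σΦ)))
          (𝕊.*-congˡ {α} (𝕊.*-congˡ {α} (𝕊.*-congˡ {α} σΦ)))))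
      (Identities.product-equation seriesRing α (α ⊗ X) (α ⊗ (α ⊗ X))
        {spread 1 e₁} {spread 2 e₂} {spread 3 e₃} {spread 4 e₄}
        {σ (spread 1 e₁)} {σ (spread 2 e₂)} {σ (spread 3 e₃)} {σ (spread 4 e₄)}
        (unfold 1 e₁ monomial₁ step₁) (unfold 2 e₂ monomial₂ step₂) (unfold 3 e₃ monomial₃ step₃)
        factor₄)

    open Identities.Twist seriesRing X α v σ τ τ-cong τ-+ τ-X τ-α τ-σ Φ equation public
      using (A; H; solution)

-- Series in x and q

ℤ-ring : CommutativeRing 0ℓ 0ℓ
ℤ-ring = ℤₚ.+-*-commutativeRing

-- A bivariate series is a series in x over the ring of series in q; its carrier is `ℤ⟦x,q⟧` by
-- computation.
module 𝕢 = PowerSeries ℤ-ring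
module 𝕂 = CommutativeRing 𝕢.seriesRing
module 𝕩 = PowerSeries 𝕢.seriesRing
module 𝕏 = CommutativeRing 𝕩.seriesRing

open Exp 𝕂.semiring using (_^_; ^-homo-*; ^-assocʳ; ^-congˡ; ^-congʳ)

q≋X : q 𝕢.≋ 𝕢.X
q≋X zero          = refl
q≋X (suc zero)    = refl
q≋X (suc (suc n)) = refl

q^⊗-suc : ∀ c f n → (q ^ suc c 𝕂.* f) n ≡ (𝕢.X 𝕂.* (q ^ c 𝕂.* f)) n
q^⊗-suc c f n = ≡.trans (𝕂.*-assoc q (q ^ c) f n) (𝕂.*-congʳ {q ^ c 𝕂.* f} q≋X n)

q^⊗-≥ : ∀ {c n} f → c ≤ n → (q ^ c 𝕂.* f) n ≡ f (n ∸ c)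
q^⊗-≥ {n = n} f z≤n               = 𝕢.1⊗ f n
q^⊗-≥ {suc c} f (s≤s {n = n} c≤n) =
  ≡.trans (q^⊗-suc c f (suc n)) (≡.trans (𝕢.X⊗-suc (q ^ c 𝕂.* f) n) (q^⊗-≥ f c≤n))

q^⊗-< : ∀ {c n} f → n < c → (q ^ c 𝕂.* f) n ≡ 0ℤ
q^⊗-< {suc c} {zero}  f _         = ≡.trans (q^⊗-suc c f 0) (𝕢.X⊗-zero (q ^ c 𝕂.* f))
q^⊗-< {suc c} {suc n} f (s≤s n<c) =
  ≡.trans (q^⊗-suc c f (suc n)) (≡.trans (𝕢.X⊗-suc (q ^ c 𝕂.* f) n) (q^⊗-< f n<c))

open Identities.Recurrences 𝕩.seriesRing 𝕩.X (Dilation.v 𝕢.seriesRing q)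

⟪⟫-zero : ∀ c S n → (⟪ c ⟫ S) 0 n ≡ 0ℤ
⟪⟫-zero c S n = 𝕩.X⊗-zero (𝕩.const (q ^ c) 𝕏.* S) n

⟪⟫-suc : ∀ c S m n → (⟪ c ⟫ S) (suc m) n ≡ (q ^ c 𝕂.* S m) n
⟪⟫-suc c S m n = ≡.trans (𝕩.X⊗-suc (𝕩.const (q ^ c) 𝕏.* S) m n) (𝕩.const⊗ (q ^ c) S m n)

⟪⟫-≥ : ∀ {c} S m {n} → c ≤ n → (⟪ c ⟫ S) (suc m) n ≡ S m (n ∸ c)
⟪⟫-≥ {c} S m {n} c≤n = ≡.trans (⟪⟫-suc c S m n) (q^⊗-≥ (S m) c≤n)

⟪⟫-< : ∀ {c} S m {n} → n < c → (⟪ c ⟫ S) m n ≡ 0ℤ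
⟪⟫-< {c} S zero    {n} n<c = ⟪⟫-zero c S n
⟪⟫-< {c} S (suc m) {n} n<c = ≡.trans (⟪⟫-suc c S m n) (q^⊗-< (S m) n<c)

-- Partitions by their smallest parts

data _◂_ (c : ℕ) (P : Pred (List ℕ) 0ℓ) : Pred (List ℕ) 0ℓ where
  cons : ∀ {π} → P π → (c ◂ P) (c ∷ π)

infixr 7 _◂_

Enumerates-◂ : ∀ {c P L} → Enumerates P L → Enumerates (c ◂ P) (map (c ∷_) L)
Enumerates-◂ {c} e = record
  { unique   = Uniqueₚ.map⁺ Listₚ.∷-injectiveʳ (unique e)
  ; sound    = snd
  ; complete = λ where (cons p) → ∈-map⁺ (c ∷_) (complete e p)
  }
  where
  snd : ∀ {π} → π ∈ map (c ∷_) _ → (c ◂ _) π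
  snd π∈ with ∈-map⁻ (c ∷_) π∈
  ... | ρ , ρ∈ , refl = cons (sound e ρ∈)

Size : ℕ → ℕ → Pred (List ℕ) 0ℓ
Size m n π = length π ≡ m × sumℕ π ≡ n

CountsAt : Pred (List ℕ) 0ℓ → ℤ⟦x,q⟧ → ℕ → ℕ → Set
CountsAt P S m n = ∃[ L ] Enumerates (P ∩ Size m n) L × S m n ≡ + length L

-- The bound on the degree in q makes the induction well-founded: up to degree `N`, only the empty
-- partition matters once all parts exceed `N`.
Counts : ℕ → Pred (List ℕ) 0ℓ → ℤ⟦x,q⟧ → Set
Counts N P S = ∀ m n → n ≤ N → CountsAt P S m n

Above : ℕ → Pred (List ℕ) 0ℓ → Set
Above c P = ∀ {d π} → P (d ∷ π) → c < d

-- One summand of a recurrence: removing the first part `c` lowers the length by 1 and the size by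
-- `c`, and `Above c Q` keeps the two classes disjoint.
branch : ∀ {N c P Q R S T U} → Counts N P S → Counts N Q T → Above c Q →
  (c ◂ P ∪ Q) ≐ R → U 𝕏.≈ ⟪ c ⟫ S 𝕏.+ T → Counts N R U
branch {N} {c} {P} {Q} {R} {S} {T} {U} P-count Q-count above (to , from) U≈ m n n≤N
  with Q-count m n n≤N
... | L′ , e′ , T≡ = go m refl
  where
  only-Q : (∀ {π} → (c ◂ P) π → ¬ Size m n π) → (⟪ c ⟫ S) m n ≡ 0ℤ → CountsAt R U m n
  only-Q ∄P S≡0 = L′ , Enumerates-≐ ((λ (p , s) → to (inj₂ p) , s) , back) e′
    , ≡.trans (U≈ m n) (≡.trans (≡.cong₂ ℤ._+_ S≡0 T≡) (ℤₚ.+-identityˡ _))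
    where
    back : R ∩ Size m n ⊆ Q ∩ Size m n
    back (r , s) with from r
    ... | inj₁ p = contradiction s (∄P p)
    ... | inj₂ p = p , s

  both : ∀ m′ → m ≡ suc m′ → c ≤ n → CountsAt R U m n
  both m′ refl c≤n with P-count m′ (n ∸ c) (ℕₚ.≤-trans (ℕₚ.m∸n≤m n c) n≤N)
  ... | L , e , S≡ = map (c ∷_) L ++ L′
    , Enumerates-≐ (forth , back) (Enumerates-∪ disjoint (Enumerates-◂ e) e′)
    , ≡.trans (U≈ m n) (≡.trans (≡.cong₂ ℤ._+_ (≡.trans (⟪⟫-≥ {c} S m′ c≤n) S≡) T≡)
        (≡.cong +_ (≡.sym (≡.trans (Listₚ.length-++ (map (c ∷_) L))
          (≡.cong (ℕ._+ length L′) (Listₚ.length-map (c ∷_) L))))))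
    where
    disjoint : ∀ {π} → (c ◂ (P ∩ Size m′ (n ∸ c))) π → ¬ (Q ∩ Size m n) π
    disjoint (cons _) (p , _) = ℕₚ.<-irrefl refl (above p)

    forth : (c ◂ (P ∩ Size m′ (n ∸ c)) ∪ (Q ∩ Size m n)) ⊆ R ∩ Size m n
    forth (inj₁ (cons (p , refl , s))) = to (inj₁ (cons p)) , refl
      , ≡.trans (≡.cong (c ℕ.+_) s) (ℕₚ.m+[n∸m]≡n c≤n)
    forth (inj₂ (p , s))               = to (inj₂ p) , s

    back : R ∩ Size m n ⊆ (c ◂ (P ∩ Size m′ (n ∸ c)) ∪ (Q ∩ Size m n))
    back (r , s) with from r | s
    ... | inj₂ p        | s₁        = inj₂ (p , s₁)
    ... | inj₁ (cons {π} p) | refl , s₁ =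
      inj₁ (cons (p , refl , ≡.trans (≡.sym (ℕₚ.m+n∸m≡n c (sumℕ π))) (≡.cong (_∸ c) s₁)))

  go : ∀ m′ → m ≡ m′ → CountsAt R U m n
  -- For length 0, or size below `c`, nothing begins with `c`, and the coefficient of the shifted
  -- series is 0 as well.
  go zero     refl = only-Q (λ where (cons _) ()) (⟪⟫-zero c S n)
  go (suc m′) refl with ℕₚ.≤-<-connex c n
  ... | inj₁ c≤n = both m′ refl c≤n
  ... | inj₂ n<c = only-Q too-big (⟪⟫-< {c} S m n<c)
    where
    too-big : ∀ {π} → (c ◂ P) π → ¬ Size m n π
    too-big (cons {π} _) (_ , s) = ℕₚ.<⇒≱ n<c (≡.subst (c ≤_) s (ℕₚ.m≤m+n c (sumℕ π)))

-- A nonempty member has a first part above `N`, hence a size above `N`.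
empty-only : ∀ {N P S} → P [] → Above N P → S 0 0 ≡ 1ℤ → (∀ n → S 0 (suc n) ≡ 0ℤ) →
  (∀ m {n} → n ≤ N → S (suc m) n ≡ 0ℤ) → Counts N P S
empty-only {P = P} empty above S₀₀ S₀ₙ Sₘ zero zero n≤N = [] ∷ [] , record
  { unique = [] ∷ [] ; sound = sound′ ; complete = complete′ } , S₀₀
  where
  sound′ : ∀ {π} → π ∈ [] ∷ [] → (P ∩ Size 0 0) π
  sound′ (here refl) = empty , refl , refl

  complete′ : ∀ {π} → (P ∩ Size 0 0) π → π ∈ [] ∷ []
  complete′ {[]} _ = here refl
empty-only {P = P} empty above S₀₀ S₀ₙ Sₘ zero (suc n) n≤N = [] , record
  { unique = [] ; sound = λ () ; complete = complete′ } , S₀ₙ n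
  where
  complete′ : ∀ {π} → (P ∩ Size 0 (suc n)) π → π ∈ []
  complete′ {[]}    (_ , _ , ())
  complete′ {_ ∷ _} (_ , () , _)
empty-only {P = P} empty above S₀₀ S₀ₙ Sₘ (suc m) n n≤N = [] , record
  { unique = [] ; sound = λ () ; complete = complete′ } , Sₘ m n≤N
  where
  complete′ : ∀ {π} → (P ∩ Size (suc m) n) π → π ∈ []
  complete′ {[]}    (_ , () , _)
  complete′ {d ∷ π} (p , _ , refl) =
    contradiction n≤N (ℕₚ.<⇒≱ (ℕₚ.<-≤-trans (above p) (ℕₚ.m≤m+n d (sumℕ π))))

-- Forbidden patterns and the splitting off of the initial run

data Forbidden : Pred (List ℕ) 0ℓ where
  forbidden₁ : ∀ {i π} → Forbidden (i ∷ i ∷ i ∷ π)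
  forbidden₂ : ∀ {i π} → Forbidden (i ∷ i ∷ 1 ℕ.+ i ∷ π)
  forbidden₃ : ∀ {i π} → Forbidden (i ∷ 1 ℕ.+ i ∷ 2 ℕ.+ i ∷ 2 ℕ.+ i ∷ π)
  forbidden₄ : ∀ {i π} → Forbidden (i ∷ 1 ℕ.+ i ∷ 2 ℕ.+ i ∷ 3 ℕ.+ i ∷ π)
  forbidden₅ : ∀ {i π} → Forbidden (i ∷ 1 ℕ.+ i ∷ 1 ℕ.+ i ∷ 3 ℕ.+ i ∷ 3 ℕ.+ i ∷ π)

-- `Forbidden` looks only at the beginning of a list; imposing its absence at every tail excludes
-- the patterns as sub-partitions.
data Partition≥ (b : ℕ) : Pred (List ℕ) 0ℓ where
  []   : Partition≥ b []
  cons : ∀ {c π} → b ≤ c → ¬ Forbidden (c ∷ π) → Partition≥ c π → Partition≥ b (c ∷ π)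

-- What the fifth pattern forbids after the run b - 3, b - 2, b - 2.
data StartsTwice (b : ℕ) : Pred (List ℕ) 0ℓ where
  twice : ∀ {π} → StartsTwice b (b ∷ b ∷ π)

NotTwice After₁₁ After₁ : ℕ → Pred (List ℕ) 0ℓ
NotTwice b = Partition≥ b ∩ ∁ (StartsTwice b)
-- What may follow b - 1, b and, apart from a second b, what may follow a first part b.
After₁₁ b = b ◂ NotTwice (2 ℕ.+ b) ∪ (suc b ◂ Partition≥ (3 ℕ.+ b) ∪ Partition≥ (2 ℕ.+ b))
After₁ b = suc b ◂ After₁₁ (suc b) ∪ Partition≥ (2 ℕ.+ b)

weaken : ∀ {b c} → b ≤ c → Partition≥ c ⊆ Partition≥ b
weaken b≤c []              = []
weaken b≤c (cons c≤d ¬f p) = cons (ℕₚ.≤-trans b≤c c≤d) ¬f p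

raise : ∀ {b π} → Partition≥ b π → (∀ {ρ} → ¬ π ≡ b ∷ ρ) → Partition≥ (suc b) π
raise []              _  = []
raise (cons b≤c ¬f p) b∉ = cons (ℕₚ.≤∧≢⇒< b≤c λ where refl → b∉ refl) ¬f p

head≥ : ∀ {b c π} → Partition≥ b (c ∷ π) → b ≤ c
head≥ (cons b≤c _ _) = b≤c

next : ∀ {b d} → b ≤ d → d ≡ b ⊎ d ≡ 1 ℕ.+ b ⊎ 2 ℕ.+ b ≤ d
next b≤d with ℕₚ.m≤n⇒m<n∨m≡n b≤d
... | inj₂ refl = inj₁ refl
... | inj₁ b<d with ℕₚ.m≤n⇒m<n∨m≡n b<d
...   | inj₂ refl = inj₂ (inj₁ refl)
...   | inj₁ 1+b<d = inj₂ (inj₂ 1+b<d)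

too-small : ∀ k {c π} → ¬ Partition≥ (suc k ℕ.+ c) (c ∷ π)
too-small k {c} p = ℕₚ.<⇒≱ (s≤s (ℕₚ.m≤n+m c k)) (head≥ p)

-- This lemma and the next four put back the possible initial runs; the digits in a name are the
-- multiplicities of b, b + 1, b + 2. A pattern starting in the run would need a next part below the
-- bound, except the fifth pattern in `cons-12`, which `NotTwice` excludes.
cons-1 : ∀ {b π} → Partition≥ (2 ℕ.+ b) π → Partition≥ b (b ∷ π)
cons-1 {b} p = cons ℕₚ.≤-refl (λ f → ok f p) (weaken (ℕₚ.m≤n+m b 2) p)
  where
  ok : ∀ {π} → Forbidden (b ∷ π) → ¬ Partition≥ (2 ℕ.+ b) π
  ok forbidden₁ p = too-small 1 p
  ok forbidden₂ p = too-small 1 p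
  ok forbidden₃ p = too-small 0 p
  ok forbidden₄ p = too-small 0 p
  ok forbidden₅ p = too-small 0 p

cons-2 : ∀ {b π} → Partition≥ (2 ℕ.+ b) π → Partition≥ b (b ∷ b ∷ π)
cons-2 {b} p = cons ℕₚ.≤-refl (λ f → ok f p) (cons-1 p)
  where
  ok : ∀ {π} → Forbidden (b ∷ b ∷ π) → ¬ Partition≥ (2 ℕ.+ b) π
  ok forbidden₁ p = too-small 1 p
  ok forbidden₂ p = too-small 0 p

cons-11 : ∀ {b π} → Partition≥ (3 ℕ.+ b) π → Partition≥ b (b ∷ 1 ℕ.+ b ∷ π)
cons-11 {b} p = cons ℕₚ.≤-refl (λ f → ok f p) (weaken (ℕₚ.n≤1+n b) (cons-1 p))
  where
  ok : ∀ {π} → Forbidden (b ∷ 1 ℕ.+ b ∷ π) → ¬ Partition≥ (3 ℕ.+ b) π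
  ok forbidden₃ p = too-small 0 p
  ok forbidden₄ p = too-small 0 p
  ok forbidden₅ p = too-small 1 p

cons-111 : ∀ {b π} → Partition≥ (4 ℕ.+ b) π → Partition≥ b (b ∷ 1 ℕ.+ b ∷ 2 ℕ.+ b ∷ π)
cons-111 {b} p = cons ℕₚ.≤-refl (λ f → ok f p) (weaken (ℕₚ.n≤1+n b) (cons-11 p))
  where
  ok : ∀ {π} → Forbidden (b ∷ 1 ℕ.+ b ∷ 2 ℕ.+ b ∷ π) → ¬ Partition≥ (4 ℕ.+ b) π
  ok forbidden₃ p = too-small 1 p
  ok forbidden₄ p = too-small 0 p

cons-12 : ∀ {b π} → NotTwice (3 ℕ.+ b) π → Partition≥ b (b ∷ 1 ℕ.+ b ∷ 1 ℕ.+ b ∷ π)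
cons-12 {b} (p , ¬t) = cons ℕₚ.≤-refl (λ f → ok f ¬t) (weaken (ℕₚ.n≤1+n b) (cons-2 p))
  where
  ok : ∀ {π} → Forbidden (b ∷ 1 ℕ.+ b ∷ 1 ℕ.+ b ∷ π) → ¬ ¬ StartsTwice (3 ℕ.+ b) π
  ok forbidden₅ ¬t = ¬t twice

cons-After₁ : ∀ {b π} → After₁ b π → Partition≥ b (b ∷ π)
cons-After₁ (inj₂ p)                             = cons-1 p
cons-After₁ (inj₁ (cons (inj₁ (cons p))))        = cons-12 p
cons-After₁ (inj₁ (cons (inj₂ (inj₁ (cons p))))) = cons-111 p
cons-After₁ (inj₁ (cons (inj₂ (inj₂ p))))        = cons-11 p

uncons-11 : ∀ {b π} → ¬ Forbidden (b ∷ 1 ℕ.+ b ∷ π) → ¬ Forbidden (1 ℕ.+ b ∷ π) →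
  Partition≥ (1 ℕ.+ b) π → After₁₁ (1 ℕ.+ b) π
uncons-11 ¬f ¬f′ [] = inj₂ (inj₂ [])
uncons-11 {b} ¬f ¬f′ (cons 1+b≤d ¬f″ p) with next 1+b≤d
... | inj₁ refl        = inj₁ (cons
  -- After b, b + 1, b + 1 the first pattern excludes b + 1 and the second excludes b + 2. The fifth
  -- then excludes a double b + 3.
  ( raise (raise p λ where refl → ¬f′ forbidden₁) (λ where refl → ¬f′ forbidden₂)
  , λ where twice → ¬f forbidden₅))
... | inj₂ (inj₁ refl) = inj₂ (inj₁ (cons
  (raise (raise p λ where refl → ¬f forbidden₃) λ where refl → ¬f forbidden₄)))
... | inj₂ (inj₂ 3+b≤d) = inj₂ (inj₂ (cons 3+b≤d ¬f″ p))

uncons : ∀ {b π} → Partition≥ b (b ∷ π) → (b ◂ Partition≥ (2 ℕ.+ b) ∪ After₁ b) π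
uncons (cons _ ¬f []) = inj₂ (inj₂ [])
uncons (cons _ ¬f (cons b≤d ¬f′ p)) with next b≤d
... | inj₁ refl         = inj₁ (cons
  (raise (raise p λ where refl → ¬f forbidden₁) λ where refl → ¬f forbidden₂))
... | inj₂ (inj₁ refl)  = inj₂ (inj₁ (cons (uncons-11 ¬f ¬f′ p)))
... | inj₂ (inj₂ 2+b≤d) = inj₂ (inj₂ (cons 2+b≤d ¬f′ p))

split : ∀ {b π} → Partition≥ b π → (∃[ ρ ] π ≡ b ∷ ρ) ⊎ Partition≥ (1 ℕ.+ b) π
split []              = inj₂ []
split (cons b≤c ¬f p) with ℕₚ.m≤n⇒m<n∨m≡n b≤c
... | inj₂ refl = inj₁ (_ , refl)
... | inj₁ b<c  = inj₂ (cons b<c ¬f p)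

-- The combinatorial counterpart of `A-recurrence`, as `NotTwice-≐` is of `H-recurrence`.
Partition≥-≐ : ∀ b →
  b ◂ (b ◂ Partition≥ (2 ℕ.+ b) ∪ After₁ b) ∪ Partition≥ (1 ℕ.+ b) ≐ Partition≥ b
Partition≥-≐ b = to , from
  where
  to : b ◂ (b ◂ Partition≥ (2 ℕ.+ b) ∪ After₁ b) ∪ Partition≥ (1 ℕ.+ b) ⊆ Partition≥ b
  to (inj₂ p)                      = weaken (ℕₚ.n≤1+n b) p
  to (inj₁ (cons (inj₁ (cons p)))) = cons-2 p
  to (inj₁ (cons (inj₂ p)))        = cons-After₁ p

  from : Partition≥ b ⊆ b ◂ (b ◂ Partition≥ (2 ℕ.+ b) ∪ After₁ b) ∪ Partition≥ (1 ℕ.+ b)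
  from p with split p
  ... | inj₁ (_ , refl) = inj₁ (cons (uncons p))
  ... | inj₂ p′         = inj₂ p′

NotTwice-≐ : ∀ b → b ◂ After₁ b ∪ Partition≥ (1 ℕ.+ b) ≐ NotTwice b
NotTwice-≐ b = to , from
  where
  to : b ◂ After₁ b ∪ Partition≥ (1 ℕ.+ b) ⊆ NotTwice b
  to (inj₂ p)        = weaken (ℕₚ.n≤1+n b) p , λ where twice → too-small 0 p
  to (inj₁ (cons p)) = cons-After₁ p , λ where twice → ¬After₁-b∷ p
    where
    ¬After₁-b∷ : ∀ {π} → ¬ After₁ b (b ∷ π)
    ¬After₁-b∷ (inj₂ p) = too-small 1 p

  from : NotTwice b ⊆ b ◂ After₁ b ∪ Partition≥ (1 ℕ.+ b)
  from (p , ¬t) with split p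
  ... | inj₂ p′         = inj₂ p′
  ... | inj₁ (_ , refl) with uncons p
  ...   | inj₁ (cons _) = contradiction twice ¬t
  ...   | inj₂ p′       = inj₁ (cons p′)

-- The recurrences determine the counts

module _
  (A H : ℕ → ℤ⟦x,q⟧) (solution : Solution A H)
  (A-low : ∀ {N} i → N < i → Counts N (Partition≥ (1 ℕ.+ i)) (A i))
  (H-low : ∀ {N} i → N < i → Counts N (NotTwice (1 ℕ.+ i)) (H i))
  where

  open Solution solution

  -- Induction on `f`, which bounds how far `i` is from exceeding `N`: the recurrences refer only to
  -- larger indices, and for i > N the hypotheses on low degrees take over.
  counts-within : ∀ f {N} i → N < i ℕ.+ f →
    Counts N (Partition≥ (1 ℕ.+ i)) (A i) × Counts N (NotTwice (1 ℕ.+ i)) (H i)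
  counts-within zero        i N<i = A-low i N<i′ , H-low i N<i′
    where N<i′ = ≡.subst (_ <_) (ℕₚ.+-identityʳ i) N<i
  counts-within (suc f) {N} i N<i =
      branch (branch (A-count 2) B′-count After₁-above ((λ p → p) , (λ p → p)) 𝕏.refl)
        (A-count 1) head≥ (Partition≥-≐ (1 ℕ.+ i)) (A-recurrence i)
    , branch B′-count (A-count 1) head≥ (NotTwice-≐ (1 ℕ.+ i)) (H-recurrence i)
    where
    earlier : ∀ k → N < (1 ℕ.+ k ℕ.+ i) ℕ.+ f
    earlier k = ℕₚ.≤-trans N<i (ℕₚ.≤-trans (ℕₚ.≤-reflexive (ℕₚ.+-suc i f))
      (s≤s (ℕₚ.+-monoˡ-≤ f (ℕₚ.m≤n+m i k))))
    A-count : ∀ k .{{_ : ℕ.NonZero k}} → Counts N (Partition≥ (1 ℕ.+ (k ℕ.+ i))) (A (k ℕ.+ i))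
    A-count (suc k) = proj₁ (counts-within f (1 ℕ.+ k ℕ.+ i) (earlier k))
    H-count : Counts N (NotTwice (4 ℕ.+ i)) (H (3 ℕ.+ i))
    H-count = proj₂ (counts-within f (3 ℕ.+ i) (earlier 2))
    C-count : Counts N (After₁₁ (2 ℕ.+ i)) (C A H (1 ℕ.+ i))
    C-count = branch H-count
      (branch (A-count 4) (A-count 3) head≥ ((λ p → p) , (λ p → p)) 𝕏.refl)
      above ((λ p → p) , (λ p → p)) 𝕏.refl
      where
      above : Above (2 ℕ.+ i) ((3 ℕ.+ i) ◂ Partition≥ (5 ℕ.+ i) ∪ Partition≥ (4 ℕ.+ i))
      above (inj₁ (cons _)) = ℕₚ.≤-refl
      above (inj₂ p)        = ℕₚ.<⇒≤ (head≥ p)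
    B′-count : Counts N (After₁ (1 ℕ.+ i)) (B′ A H i)
    B′-count = branch C-count (A-count 2) head≥ ((λ p → p) , (λ p → p)) 𝕏.refl
    After₁-above : Above (1 ℕ.+ i) (After₁ (1 ℕ.+ i))
    After₁-above (inj₁ (cons _)) = ℕₚ.≤-refl
    After₁-above (inj₂ p)        = ℕₚ.<⇒≤ (head≥ p)

-- The quadruple series

module 𝕀 = Identities 𝕢.seriesRing

⊛≋* : ∀ f g → f ⊛ g 𝕂.≈ f 𝕂.* g
⊛≋* f g n = ≡.sym (𝕢.⊗-applyUpTo f g n)

𝟙≋1 : 𝟙 𝕂.≈ 𝕂.1#
𝟙≋1 zero    = refl
𝟙≋1 (suc n) = refl

^ˢ≋^ : ∀ f n → f ^ˢ n 𝕂.≈ f ^ n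
^ˢ≋^ f zero    = 𝟙≋1
^ˢ≋^ f (suc n) = 𝕂.trans (⊛≋* f (f ^ˢ n)) (𝕂.*-congˡ {f} (^ˢ≋^ f n))

reciprocal : ℤ⟦q⟧ → ℕ → ℤ⟦q⟧
reciprocal a i = 𝟙 ⊘ ⟨ a ﹔ a ⟩ i

reciprocal-inverse : ∀ {a} → a 0 ≡ 0ℤ → ∀ i → reciprocal a i 𝕂.* ⟨ a ﹔ a ⟩ i 𝕂.≈ 𝕂.1#
reciprocal-inverse {a} a₀ i = 𝕂.trans (𝕂.sym (⊛≋* (reciprocal a i) (⟨ a ﹔ a ⟩ i)))
  (𝕂.trans (⊘-correct 𝟙 (⟨ a ﹔ a ⟩ i) (⟨﹔⟩-constant a a a₀ i)) 𝟙≋1)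

-- From (a; a)_{i+1} = (a; a)_i (1 - a^{i+1}), where a^{i+1} = q^{s(i+1)}.
reciprocal-step : ∀ {a} s → a 0 ≡ 0ℤ → a 𝕂.≈ q ^ s → ∀ i →
  reciprocal a (suc i) 𝕂.≈ reciprocal a i 𝕂.+ q ^ (suc i ℕ.* s) 𝕂.* reciprocal a (suc i)
reciprocal-step {a} s a₀ a≈ i = 𝕀.inverse-step {⟨ a ﹔ a ⟩ i} {⟨ a ﹔ a ⟩ (suc i)}
  (reciprocal-inverse a₀ i) (reciprocal-inverse a₀ (suc i))
  (𝕂.trans (⊛≋* (⟨ a ﹔ a ⟩ i) (𝟙 ⊖ a ⊛ (a ^ˢ i)))
    (𝕂.*-congˡ {⟨ a ﹔ a ⟩ i} (𝕂.+-cong 𝟙≋1 (𝕂.-‿cong power))))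
  where
  power : a ⊛ (a ^ˢ i) 𝕂.≈ q ^ (suc i ℕ.* s)
  power = 𝕂.trans (⊛≋* a (a ^ˢ i)) (𝕂.trans (𝕂.*-congˡ {a} (^ˢ≋^ a i))
    (𝕂.trans (^-congˡ (suc i) a≈) (𝕂.trans (^-assocʳ q s (suc i)) (^-congʳ q (ℕₚ.*-comm s (suc i))))))

-- Equal to (-1)^l q^{2l² + 2l}; the recursive form gives the ratio of consecutive terms that
-- `step₄` uses.
signed : ℕ → ℤ⟦q⟧
signed zero    = 𝕂.1#
signed (suc l) = 𝕂.- (q ^ (suc l ℕ.* 4) 𝕂.* signed l)

-- Euler's coefficients of z^i, z^{2j}, z^{3k}, z^{4l} in 1/(zq; q), 1/(z²q; q²), 1/(z³q²; q³) and
-- (z⁴q⁴; q⁴).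
e₁ e₂ e₃ e₄ : ℕ → ℤ⟦q⟧
e₁ i = q ^ i 𝕂.* reciprocal q i
e₂ j = q ^ j 𝕂.* reciprocal (q ^ˢ 2) j
e₃ k = (q 𝕂.* q) ^ k 𝕂.* reciprocal (q ^ˢ 3) k
e₄ l = signed l 𝕂.* reciprocal (q ^ˢ 4) l

q≈q^1 : q 𝕂.≈ q ^ 1
q≈q^1 = 𝕂.sym (𝕂.trans (𝕂.*-comm q 𝕂.1#) (𝕂.*-identityˡ q))

weighted : ∀ {a} s y → a 0 ≡ 0ℤ → a 𝕂.≈ q ^ s → ∀ i →
  y ^ suc i 𝕂.* reciprocal a (suc i)
    𝕂.≈ q ^ (suc i ℕ.* s) 𝕂.* (y ^ suc i 𝕂.* reciprocal a (suc i)) 𝕂.+ y 𝕂.* (y ^ i 𝕂.* reciprocal a i)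
weighted {a} s y a₀ a≈ i = 𝕀.weighted-step {reciprocal a i} {reciprocal a (suc i)} {q ^ (suc i ℕ.* s)}
  y (y ^ i) (reciprocal-step s a₀ a≈ i)

step₄ : ∀ l → q ^ (suc l ℕ.* 4) 𝕂.* e₄ (suc l)
  𝕂.≈ e₄ (suc l) 𝕂.+ q 𝕂.* (q 𝕂.* (q 𝕂.* q)) 𝕂.* (q ^ (l ℕ.* 4) 𝕂.* e₄ l)
step₄ l = 𝕂.trans
  (𝕀.signed-step {reciprocal (q ^ˢ 4) l} {reciprocal (q ^ˢ 4) (suc l)}
    {q ^ (suc l ℕ.* 4)} {signed l} {signed (suc l)}
    (reciprocal-step {q ^ˢ 4} 4 refl (^ˢ≋^ q 4) l)
    (𝕂.-‿inverseˡ (q ^ (suc l ℕ.* 4) 𝕂.* signed l)))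
  (𝕂.+-congˡ {e₄ (suc l)} (rearrange q (q ^ (l ℕ.* 4)) (e₄ l)))
  where
  rearrange : ∀ q u e → q 𝕂.* (q 𝕂.* (q 𝕂.* (q 𝕂.* u))) 𝕂.* e 𝕂.≈ q 𝕂.* (q 𝕂.* (q 𝕂.* q)) 𝕂.* (u 𝕂.* e)
  rearrange = 𝕀.rearrange₄

open Dilation.Product 𝕢.seriesRing q e₁ e₂ e₃ e₄
  (weighted {q} 1 q refl q≈q^1) (weighted {q ^ˢ 2} 2 q refl (^ˢ≋^ q 2))
  (weighted {q ^ˢ 3} 3 (q 𝕂.* q) refl (^ˢ≋^ q 3)) step₄
  using (Φ; A; H; solution)

open Dilation 𝕢.seriesRing q using (spread-*)

-- Low degrees, the base of the induction

Φ₀≈1 : Φ 0 𝕂.≈ 𝕂.1#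
Φ₀≈1 = 𝕂.trans
  (𝕂.*-cong (𝕂.trans (spread-* 1 e₁ 0) (at-0 {q} refl))
  (𝕂.*-cong (𝕂.trans (spread-* 2 e₂ 0) (at-0 {q ^ˢ 2} refl))
  (𝕂.*-cong (𝕂.trans (spread-* 3 e₃ 0) (at-0 {q ^ˢ 3} refl))
            (𝕂.trans (spread-* 4 e₄ 0) (at-0 {q ^ˢ 4} refl)))))
  (𝕂.trans (𝕂.*-identityˡ _) (𝕂.trans (𝕂.*-identityˡ _) (𝕂.*-identityˡ 𝕂.1#)))
  where
  at-0 : ∀ {a} → a 0 ≡ 0ℤ → 𝕂.1# 𝕂.* reciprocal a 0 𝕂.≈ 𝕂.1#
  at-0 {a} a₀ = 𝕂.trans (𝕂.*-comm 𝕂.1# (reciprocal a 0))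
    (𝕂.trans (𝕂.*-congˡ {reciprocal a 0} (𝕂.sym 𝟙≋1)) (reciprocal-inverse {a} a₀ 0))

A₀≈1 : ∀ i → A i 0 𝕂.≈ 𝕂.1#
A₀≈1 i = 𝕂.trans (𝕂.*-congʳ {Φ 0} (^-congʳ q (ℕₚ.*-zeroʳ i))) (𝕂.trans (𝕂.*-identityˡ (Φ 0)) Φ₀≈1)

-- The weight of x^{m+1} is a power of q whose exponent is at least i (m + 1), hence above `N`.
A-low : ∀ {N} i m {n} → N < i → n ≤ N → A i (suc m) n ≡ 0ℤ
A-low i m N<i n≤N = q^⊗-< (Φ (suc m)) (ℕₚ.<-≤-trans (ℕₚ.≤-<-trans n≤N N<i)
  (ℕₚ.≤-trans (ℕₚ.m≤m*n i (suc m)) (ℕₚ.m≤n+m _ (triangle (suc m)))))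

A-counts-low : ∀ {N} i → N < i → Counts N (Partition≥ (1 ℕ.+ i)) (A i)
A-counts-low i N<i = empty-only [] (λ p → ℕₚ.<-trans N<i (head≥ p)) (A₀≈1 i 0) (λ n → A₀≈1 i (suc n))
  (λ m n≤N → A-low i m N<i n≤N)

-- The part of `H i` that is subtracted from `A i` is divisible by q^{1+i}.
H≡A : ∀ {N} i m {n} → N < i → n ≤ N → H i m n ≡ A i m n
H≡A i m {n} N<i n≤N = ≡.trans
  (≡.cong (λ z → A i m n ℤ.- z) (⟪⟫-< {1 ℕ.+ i} (⟪ 1 ℕ.+ i ⟫ A (2 ℕ.+ i)) m
    (s≤s (ℕₚ.≤-trans n≤N (ℕₚ.<⇒≤ N<i)))))
  (ℤₚ.+-identityʳ _)

H-counts-low : ∀ {N} i → N < i → Counts N (NotTwice (1 ℕ.+ i)) (H i)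
H-counts-low {N} i N<i m n n≤N with A-counts-low i N<i m n n≤N
... | L , e , A≡ = L , Enumerates-≐ (to , λ where ((p , _) , s) → p , s) e
  , ≡.trans (H≡A i m N<i n≤N) A≡
  where
  to : Partition≥ (1 ℕ.+ i) ∩ Size m n ⊆ NotTwice (1 ℕ.+ i) ∩ Size m n
  to (p , len , s) = (p , ¬t) , len , s
    where
    ¬t : ¬ StartsTwice (1 ℕ.+ i) _
    ¬t (twice {π}) = ℕₚ.<⇒≱ N<i (ℕₚ.≤-trans (ℕₚ.n≤1+n i)
      (ℕₚ.≤-trans (ℕₚ.m≤m+n (1 ℕ.+ i) _) (ℕₚ.≤-trans (ℕₚ.≤-reflexive s) n≤N)))

A-counts : ∀ N → Counts N (Partition≥ 2) (A 1)
-- Index 1 corresponds to b = 2, and N steps suffice because N < 1 + N.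
A-counts N = proj₁ (counts-within A H solution A-counts-low H-counts-low N 1 ℕₚ.≤-refl)

-- The class `𝒫` as the partitions with parts at least 2

tails-avoid : ∀ {b π} → Linked _≤_ (b ∷ π) → (∀ xs {ρ} → π ≡ xs ++ ρ → ¬ Forbidden ρ) → Partition≥ b π
tails-avoid [-]         avoid = []
tails-avoid (b≤c ∷ inc) avoid = cons b≤c (avoid [] refl)
  (tails-avoid inc λ xs eq → avoid (_ ∷ xs) (≡.cong (_ ∷_) eq))

𝒫⊆Partition≥2 : 𝒫 ⊆ Partition≥ 2
-- Positive parts different from 1 are at least 2, so 2 may be placed in front of the list without
-- spoiling its order.
𝒫⊆Partition≥2 {π} p = tails-avoid (linked π positive no-1 increasing) avoid
  where
  open 𝒫 p
  open IsPartition isPartition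

  linked : ∀ π → All (1 ≤_) π → ¬ 1 ∈ π → Linked _≤_ π → Linked _≤_ (2 ∷ π)
  linked []      _         _   _   = [-]
  linked (c ∷ π) (1≤c ∷ _) 1∉π inc = ℕₚ.≤∧≢⇒< 1≤c (1∉π ∘ here) ∷ inc

  avoid : ∀ xs {ρ} → π ≡ xs ++ ρ → ¬ Forbidden ρ
  avoid xs refl f with Allₚ.++⁻ʳ xs positive
  avoid xs refl (forbidden₁ {i}) | 1≤i ∷ _ = avoids₁ i 1≤i (xs Infix.++ⁱ Infix.here (refl ∷ refl ∷ refl ∷ []))
  avoid xs refl (forbidden₂ {i}) | 1≤i ∷ _ = avoids₂ i 1≤i
    (xs Infix.++ⁱ Infix.here (refl ∷ refl ∷ ℕₚ.+-comm i 1 ∷ []))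
  avoid xs refl (forbidden₃ {i}) | 1≤i ∷ _ = avoids₃ i 1≤i
    (xs Infix.++ⁱ Infix.here (refl ∷ ℕₚ.+-comm i 1 ∷ ℕₚ.+-comm i 2 ∷ ℕₚ.+-comm i 2 ∷ []))
  avoid xs refl (forbidden₄ {i}) | 1≤i ∷ _ = avoids₄ i 1≤i
    (xs Infix.++ⁱ Infix.here (refl ∷ ℕₚ.+-comm i 1 ∷ ℕₚ.+-comm i 2 ∷ ℕₚ.+-comm i 3 ∷ []))
  avoid xs refl (forbidden₅ {i}) | 1≤i ∷ _ = avoids₅ i 1≤i
    (xs Infix.++ⁱ Infix.here (refl ∷ ℕₚ.+-comm i 1 ∷ ℕₚ.+-comm i 1 ∷ ℕₚ.+-comm i 3 ∷ ℕₚ.+-comm i 3 ∷ []))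

Partition≥⇒All : ∀ {b π} → Partition≥ b π → All (b ≤_) π
Partition≥⇒All []             = []
Partition≥⇒All (cons b≤c _ p) = b≤c ∷ All.map (ℕₚ.≤-trans b≤c) (Partition≥⇒All p)

Partition≥⇒Linked : ∀ {b π} → Partition≥ b π → Linked _≤_ π
Partition≥⇒Linked []                                = []
Partition≥⇒Linked (cons _ _ [])                     = [-]
Partition≥⇒Linked (cons _ _ p@(cons c≤d _ _))       = c≤d ∷ Partition≥⇒Linked p

-- An infix is a prefix of some tail, and `Partition≥` excludes `Forbidden` at each nonempty tail.
no-infix : ∀ {b as π} → (∀ {ρ} → Prefix _≡_ as ρ → Forbidden ρ) → Partition≥ b π → ¬ as SubPartitionOf π
no-infix bad []            (Infix.here pre) with bad pre
... | ()
no-infix bad (cons _ ¬f _) (Infix.here pre)  = ¬f (bad pre)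
no-infix bad (cons _ _ p)  (Infix.there inf) = no-infix bad p inf

Partition≥2⊆𝒫 : Partition≥ 2 ⊆ 𝒫
Partition≥2⊆𝒫 p = record
  { isPartition = record
    { positive   = All.map ℕₚ.<⇒≤ (Partition≥⇒All p)
    ; increasing = Partition≥⇒Linked p
    }
  ; no-1    = λ 1∈π → ℕₚ.<-irrefl refl (All.lookup (Partition≥⇒All p) 1∈π)
  ; avoids₁ = λ i _ → no-infix (bad₁ i) p
  ; avoids₂ = λ i _ → no-infix (bad₂ i) p
  ; avoids₃ = λ i _ → no-infix (bad₃ i) p
  ; avoids₄ = λ i _ → no-infix (bad₄ i) p
  ; avoids₅ = λ i _ → no-infix (bad₅ i) p
  }
  where
  bad₁ : ∀ i {ρ} → Prefix _≡_ (i ∷ i ∷ i ∷ []) ρ → Forbidden ρ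
  bad₁ i (refl ∷ refl ∷ refl ∷ _) = forbidden₁
  bad₂ : ∀ i {ρ} → Prefix _≡_ (i ∷ i ∷ i ℕ.+ 1 ∷ []) ρ → Forbidden ρ
  bad₂ i rewrite ℕₚ.+-comm i 1 = λ where (refl ∷ refl ∷ refl ∷ _) → forbidden₂
  bad₃ : ∀ i {ρ} → Prefix _≡_ (i ∷ i ℕ.+ 1 ∷ i ℕ.+ 2 ∷ i ℕ.+ 2 ∷ []) ρ → Forbidden ρ
  bad₃ i rewrite ℕₚ.+-comm i 1 | ℕₚ.+-comm i 2 = λ where (refl ∷ refl ∷ refl ∷ refl ∷ _) → forbidden₃
  bad₄ : ∀ i {ρ} → Prefix _≡_ (i ∷ i ℕ.+ 1 ∷ i ℕ.+ 2 ∷ i ℕ.+ 3 ∷ []) ρ → Forbidden ρ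
  bad₄ i rewrite ℕₚ.+-comm i 1 | ℕₚ.+-comm i 2 | ℕₚ.+-comm i 3 =
    λ where (refl ∷ refl ∷ refl ∷ refl ∷ _) → forbidden₄
  bad₅ : ∀ i {ρ} → Prefix _≡_ (i ∷ i ℕ.+ 1 ∷ i ℕ.+ 1 ∷ i ℕ.+ 3 ∷ i ℕ.+ 3 ∷ []) ρ → Forbidden ρ
  bad₅ i rewrite ℕₚ.+-comm i 1 | ℕₚ.+-comm i 3 =
    λ where (refl ∷ refl ∷ refl ∷ refl ∷ refl ∷ _) → forbidden₅

-- From counts to formal sums over partitions

x^-same : ∀ M f n → (x^ M · f) M n ≡ f n
x^-same M f n with M ℕ.≟ M
... | yes _  = refl
... | no M≢M = contradiction refl M≢M

x^-support : ∀ M f m n → (x^ M · f) m n ≢ 0ℤ → m ≡ M × f n ≢ 0ℤ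
x^-support M f m n nz with m ℕ.≟ M
... | yes m≡M = m≡M , nz
... | no  _   = contradiction refl nz

-- The trailing factor 1 brings the power into the shape to which the shift lemmas `q^⊗-≥` and
-- `q^⊗-<` apply.
q^ˢ≈ : ∀ s → q ^ˢ s 𝕂.≈ q ^ s 𝕂.* 𝕂.1#
q^ˢ≈ s = 𝕂.trans (^ˢ≋^ q s) (𝕂.trans (𝕂.sym (𝕂.*-identityˡ (q ^ s))) (𝕂.*-comm 𝕂.1# (q ^ s)))

q^ˢ-same : ∀ n → (q ^ˢ n) n ≡ 1ℤ
q^ˢ-same n = ≡.trans (q^ˢ≈ n n) (≡.trans (q^⊗-≥ {n} 𝕂.1# ℕₚ.≤-refl) (≡.cong 𝕂.1# (ℕₚ.n∸n≡0 n)))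

q^ˢ-support : ∀ s n → (q ^ˢ s) n ≢ 0ℤ → s ≡ n
q^ˢ-support s n nz with ℕₚ.<-cmp s n
... | tri≈ _ s≡n _ = s≡n
... | tri> _ _ n<s = contradiction (≡.trans (q^ˢ≈ s n) (q^⊗-< 𝕂.1# n<s)) nz
... | tri< s<n _ _ = contradiction (≡.trans (q^ˢ≈ s n) (≡.trans (q^⊗-≥ 𝕂.1# (ℕₚ.<⇒≤ s<n)) vanish)) nz
  where
  vanish : 𝕂.1# (n ∸ s) ≡ 0ℤ
  vanish with n ∸ s | ℕₚ.m<n⇒0<n∸m s<n
  ... | suc _ | _ = refl

ones : ∀ {m n} L → (∀ {π} → π ∈ L → Size m n π) → sumℤ (map (λ π → partitionTerm π m n) L) ≡ + length L
ones []      size = refl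
ones (π ∷ L) size with size (here refl)
... | refl , refl = ≡.cong₂ ℤ._+_
  (≡.trans (x^-same (length π) (q ^ˢ sumℕ π) (sumℕ π)) (q^ˢ-same (sumℕ π)))
  (ones L (size ∘ there))

counted-sum : ∀ {P S} → (∀ m n → CountsAt P S m n) → S IsSumOf partitionTerm Over P
counted-sum {P} {S} count = record
  { terms    = λ m n → proj₁ (count m n)
  ; unique   = λ m n → Enumerates.unique (enumeration m n)
  ; sound    = λ m n → All.tabulate (λ π∈ → proj₁ (Enumerates.sound (enumeration m n) π∈))
  ; complete = complete′
  ; total    = λ m n → ≡.trans (proj₂ (proj₂ (count m n)))
      (≡.sym (ones (proj₁ (count m n)) (λ π∈ → proj₂ (Enumerates.sound (enumeration m n) π∈))))
  }
  where
  enumeration : ∀ m n → Enumerates (P ∩ Size m n) (proj₁ (count m n))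
  enumeration m n = proj₁ (proj₂ (count m n))

  complete′ : ∀ m n π → P π → partitionTerm π m n ≢ 0ℤ → π ∈ proj₁ (count m n)
  complete′ m n π p nz with x^-support (length π) (q ^ˢ sumℕ π) m n nz
  ... | m≡ , nz′ = Enumerates.complete (enumeration m n) (p , ≡.sym m≡ , q^ˢ-support (sumℕ π) n nz′)

partition-sum : A 1 IsSumOf partitionTerm Over 𝒫
partition-sum = counted-sum λ m n →
  let (L , e , A≡) = A-counts n m n ℕₚ.≤-refl in
  L , Enumerates-≐ ((λ (p , s) → Partition≥2⊆𝒫 p , s) , (λ (p , s) → 𝒫⊆Partition≥2 p , s)) e , A≡

-- Closed forms and the sum over quadruples

signed-closed : ∀ l → signed l 𝕂.≈ 𝕢.const (-1ℤ ℤ.^ l) 𝕂.* q ^ (2 ℕ.* l ℕ.^ 2 ℕ.+ 2 ℕ.* l)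
signed-closed zero    = 𝕂.sym (𝕂.*-identityˡ 𝕂.1#)
signed-closed (suc l) = 𝕂.trans (𝕂.-‿cong (𝕂.*-congˡ {q ^ (suc l ℕ.* 4)} (signed-closed l)))
  (𝕂.trans (𝕀.negate-middle (q ^ (suc l ℕ.* 4)) (𝕢.const (-1ℤ ℤ.^ l)) (q ^ (2 ℕ.* l ℕ.^ 2 ℕ.+ 2 ℕ.* l)))
  (𝕂.*-cong sign (𝕂.trans (𝕂.sym (^-homo-* q (suc l ℕ.* 4) _)) (^-congʳ q exponent))))
  where
  sign : 𝕂.- 𝕢.const (-1ℤ ℤ.^ l) 𝕂.≈ 𝕢.const (-1ℤ ℤ.^ suc l)
  sign zero    = ≡.sym (ℤₚ.-1*i≡-i (-1ℤ ℤ.^ l))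
  sign (suc n) = refl

  exponent : suc l ℕ.* 4 ℕ.+ (2 ℕ.* l ℕ.^ 2 ℕ.+ 2 ℕ.* l) ≡ 2 ℕ.* suc l ℕ.^ 2 ℕ.+ 2 ℕ.* suc l
  exponent = solve 1 (λ l →
    (con 1 :+ l) :* con 4 :+ (con 2 :* (l :* (l :* con 1)) :+ con 2 :* l)
    := con 2 :* ((con 1 :+ l) :* ((con 1 :+ l) :* con 1)) :+ con 2 :* (con 1 :+ l)) refl l
    where open +-*-Solver

triangle-double : ∀ n → n ℕ.* (n ∸ 1) ≡ triangle n ℕ.* 2
triangle-double zero          = refl
triangle-double (suc zero)    = refl
triangle-double (suc (suc n)) = ≡.trans
  (solve 1 (λ n → (con 2 :+ n) :* (con 1 :+ n) := (con 1 :+ n) :* con 2 :+ (con 1 :+ n) :* n) refl n)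
  (≡.trans (≡.cong (suc n ℕ.* 2 ℕ.+_) (triangle-double (suc n)))
    (≡.sym (ℕₚ.*-distribʳ-+ 2 (suc n) (triangle (suc n)))))
  where open +-*-Solver

triangle-/ : ∀ n → n ℕ.* (n ∸ 1) ℕ./ 2 ≡ triangle n
triangle-/ n = ≡.trans (≡.cong (ℕ._/ 2) (triangle-double n)) (DivMod.m*n/n≡m (triangle n) 2)

Quadruple : Set
Quadruple = ℕ × ℕ × ℕ × ℕ

-- The exponent M in the form that the lists `quotients` and `convolve` produce.
weight : Quadruple → ℕ
weight (i , j , k , l) = i ℕ.* 1 ℕ.+ (j ℕ.* 2 ℕ.+ (k ℕ.* 3 ℕ.+ l ℕ.* 4))

quadruples : ℕ → List Quadruple
quadruples = convolve (quotients 1) (convolve (quotients 2) (convolve (quotients 3) (quotients 4)))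

quadruples-enumerate : ∀ m → Enumerates (λ t → weight t ≡ m) (quadruples m)
quadruples-enumerate =
  convolve-enumerates (quotients-enumerate 1) (convolve-enumerates (quotients-enumerate 2)
    (convolve-enumerates (quotients-enumerate 3) (quotients-enumerate 4)))

summand : Quadruple → ℤ⟦q⟧
summand (i , j , k , l) = e₁ i 𝕂.* (e₂ j 𝕂.* (e₃ k 𝕂.* e₄ l))

module Σ𝕂 = FiniteSum 𝕢.seriesRing

-- Each factor of `Φ` is by definition a sum over `quotients`, so the coefficient of a fourfold
-- product is a sum over the convolved lists.
Φ-sum : ∀ m → Σ𝕂.Σ⟨ quadruples m ⟩ summand 𝕂.≈ Φ m
Φ-sum = Σ𝕂.Σ-convolve₄ e₁ e₂ e₃ e₄ (quotients 1) (quotients 2) (quotients 3) (quotients 4)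

-- These, together with `denominator`, agree by computation with the local `M`, `E` and `D` of
-- `quadrupleTerm`.
xExponent qExponent : Quadruple → ℕ
xExponent (i , j , k , l) = i ℕ.+ 2 ℕ.* j ℕ.+ 3 ℕ.* k ℕ.+ 4 ℕ.* l
qExponent t@(i , j , k , l) =
  xExponent t ℕ.* (xExponent t ∸ 1) ℕ./ 2 ℕ.+ 2 ℕ.* l ℕ.^ 2 ℕ.+ 2 ℕ.* i ℕ.+ 3 ℕ.* j ℕ.+ 5 ℕ.* k ℕ.+ 6 ℕ.* l

weight-xExponent : ∀ t → weight t ≡ xExponent t
weight-xExponent (i , j , k , l) = solve 4 (λ i j k l →
  i :* con 1 :+ (j :* con 2 :+ (k :* con 3 :+ l :* con 4))
  := i :+ con 2 :* j :+ con 3 :* k :+ con 4 :* l) refl i j k l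
  where open +-*-Solver

denominator : Quadruple → ℤ⟦q⟧
denominator (i , j , k , l) =
  ⟨ q ﹔ q ⟩ i ⊛ ⟨ q ^ˢ 2 ﹔ q ^ˢ 2 ⟩ j ⊛ ⟨ q ^ˢ 3 ﹔ q ^ˢ 3 ⟩ k ⊛ ⟨ q ^ˢ 4 ﹔ q ^ˢ 4 ⟩ l

coefficient : Quadruple → ℤ⟦q⟧
coefficient t@(i , j , k , l) = ((-1ℤ ℤ.^ l) · (q ^ˢ qExponent t)) ⊘ denominator t

denominator₀ : ∀ t → denominator t 0 ≡ 1ℤ
denominator₀ (i , j , k , l)
  rewrite ⟨﹔⟩-constant q q refl i | ⟨﹔⟩-constant (q ^ˢ 2) (q ^ˢ 2) refl j
        | ⟨﹔⟩-constant (q ^ˢ 3) (q ^ˢ 3) refl k | ⟨﹔⟩-constant (q ^ˢ 4) (q ^ˢ 4) refl l = refl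

denominator≈ : ∀ i j k l → denominator (i , j , k , l) 𝕂.≈
  ⟨ q ﹔ q ⟩ i 𝕂.* ⟨ q ^ˢ 2 ﹔ q ^ˢ 2 ⟩ j 𝕂.* ⟨ q ^ˢ 3 ﹔ q ^ˢ 3 ⟩ k 𝕂.* ⟨ q ^ˢ 4 ﹔ q ^ˢ 4 ⟩ l
denominator≈ i j k l = 𝕂.trans (⊛≋* (d₁ ⊛ d₂ ⊛ d₃) d₄) (𝕂.*-congʳ {d₄}
  (𝕂.trans (⊛≋* (d₁ ⊛ d₂) d₃) (𝕂.*-congʳ {d₃} (⊛≋* d₁ d₂))))
  where
  d₁ = ⟨ q ﹔ q ⟩ i
  d₂ = ⟨ q ^ˢ 2 ﹔ q ^ˢ 2 ⟩ j
  d₃ = ⟨ q ^ˢ 3 ﹔ q ^ˢ 3 ⟩ k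
  d₄ = ⟨ q ^ˢ 4 ﹔ q ^ˢ 4 ⟩ l

numerator≈ : ((i , j , k , l) : Quadruple) → let t = i , j , k , l in (-1ℤ ℤ.^ l) · (q ^ˢ qExponent t) 𝕂.≈
  q ^ (triangle (xExponent t) ℕ.+ 1 ℕ.* xExponent t)
    𝕂.* (q ^ i 𝕂.* (q ^ j 𝕂.* ((q 𝕂.* q) ^ k 𝕂.* signed l)))
numerator≈ t@(i , j , k , l) = 𝕂.sym (𝕂.trans
  (𝕂.*-congˡ {q ^ a} (𝕂.*-congˡ {q ^ i} (𝕂.*-congˡ {q ^ j} (𝕂.*-cong qq (signed-closed l)))))
  (𝕂.trans (𝕀.pull-out (q ^ a) (q ^ i) (q ^ j) (q ^ (2 ℕ.* k)) c (q ^ w))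
  (𝕂.trans (𝕂.*-congˡ {c} combine)
  (𝕂.trans (𝕢.const⊗ (-1ℤ ℤ.^ l) (q ^ e))
    (λ n → ≡.cong ((-1ℤ ℤ.^ l) ℤ.*_)
      (≡.trans (^-congʳ q exponent n) (≡.sym (^ˢ≋^ q (qExponent t) n))))))))
  where
  M a w e : ℕ
  M = xExponent t
  a = triangle M ℕ.+ 1 ℕ.* M
  w = 2 ℕ.* l ℕ.^ 2 ℕ.+ 2 ℕ.* l
  e = a ℕ.+ (i ℕ.+ (j ℕ.+ (2 ℕ.* k ℕ.+ w)))

  c : ℤ⟦q⟧
  c = 𝕢.const (-1ℤ ℤ.^ l)

  qq : (q 𝕂.* q) ^ k 𝕂.≈ q ^ (2 ℕ.* k)
  qq = 𝕂.trans (^-congˡ k (𝕂.*-congˡ {q} q≈q^1)) (^-assocʳ q 2 k)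

  combine : q ^ a 𝕂.* (q ^ i 𝕂.* (q ^ j 𝕂.* (q ^ (2 ℕ.* k) 𝕂.* q ^ w))) 𝕂.≈ q ^ e
  combine = 𝕂.sym (𝕂.trans (^-homo-* q a _) (𝕂.*-congˡ {q ^ a} (𝕂.trans (^-homo-* q i _)
    (𝕂.*-congˡ {q ^ i} (𝕂.trans (^-homo-* q j _) (𝕂.*-congˡ {q ^ j} (^-homo-* q (2 ℕ.* k) w)))))))

  exponent : e ≡ qExponent t
  exponent rewrite triangle-/ M = solve 5 (λ T i j k l →
    T :+ con 1 :* (i :+ con 2 :* j :+ con 3 :* k :+ con 4 :* l)
      :+ (i :+ (j :+ (con 2 :* k :+ (con 2 :* (l :* (l :* con 1)) :+ con 2 :* l))))
    := T :+ con 2 :* (l :* (l :* con 1)) :+ con 2 :* i :+ con 3 :* j :+ con 5 :* k :+ con 6 :* l)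
    refl (triangle M) i j k l
    where open +-*-Solver

-- The factor in front of `summand` is the weight of `τ 1` at M, with exponent M(M-1)/2 + M. The
-- equality follows by clearing the denominators, which are invertible.
coefficient≈ : ∀ t → coefficient t 𝕂.≈ q ^ (triangle (xExponent t) ℕ.+ 1 ℕ.* xExponent t) 𝕂.* summand t
coefficient≈ t@(i , j , k , l) = 𝕀.quotient-of-product
  {⟨ q ﹔ q ⟩ i} {⟨ q ^ˢ 2 ﹔ q ^ˢ 2 ⟩ j} {⟨ q ^ˢ 3 ﹔ q ^ˢ 3 ⟩ k} {⟨ q ^ˢ 4 ﹔ q ^ˢ 4 ⟩ l}
  {reciprocal q i} {reciprocal (q ^ˢ 2) j} {reciprocal (q ^ˢ 3) k} {reciprocal (q ^ˢ 4) l}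
  {q ^ i} {q ^ j} {(q 𝕂.* q) ^ k} {signed l}
  {q ^ (triangle (xExponent t) ℕ.+ 1 ℕ.* xExponent t)} {coefficient t}
  (reciprocal-inverse {q} refl i) (reciprocal-inverse {q ^ˢ 2} refl j)
  (reciprocal-inverse {q ^ˢ 3} refl k) (reciprocal-inverse {q ^ˢ 4} refl l)
  (𝕂.trans (𝕂.*-congˡ {coefficient t} (𝕂.sym (denominator≈ i j k l)))
  (𝕂.trans (𝕂.sym (⊛≋* (coefficient t) (denominator t)))
  (𝕂.trans (⊘-correct ((-1ℤ ℤ.^ l) · (q ^ˢ qExponent t)) (denominator t) (denominator₀ t))
    (numerator≈ t))))

sum-coefficient : ∀ (f : Quadruple → ℤ⟦q⟧) L n → Σ𝕂.Σ⟨ L ⟩ f n ≡ sumℤ (map (λ t → f t n) L)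
sum-coefficient f []      n = refl
sum-coefficient f (t ∷ L) n = ≡.cong (ℤ._+_ (f t n)) (sum-coefficient f L n)

quadruple-sum : A 1 IsSumOf quadrupleTerm Over U
quadruple-sum = record
  { terms    = λ m n → quadruples m
  ; unique   = λ m n → Enumerates.unique (quadruples-enumerate m)
  ; sound    = λ m n → All.tabulate (λ _ → tt)
  ; complete = λ m n t _ nz → Enumerates.complete (quadruples-enumerate m)
      (≡.trans (weight-xExponent t) (≡.sym (proj₁ (x^-support (xExponent t) (coefficient t) m n nz))))
  ; total    = total
  }
  where
  total : ∀ m n → A 1 m n ≡ sumℤ (map (λ t → quadrupleTerm t m n) (quadruples m))
  total m n = begin
    (u 𝕂.* Φ m) n                                        ≡⟨ 𝕂.*-congˡ {u} (Φ-sum m) n ⟨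
    (u 𝕂.* Σ𝕂.Σ⟨ quadruples m ⟩ summand) n                ≡⟨ Σ𝕂.Σ-*ˡ summand u (quadruples m) n ⟨
    Σ𝕂.Σ⟨ quadruples m ⟩ (λ t → u 𝕂.* summand t) n        ≡⟨ sum-coefficient _ (quadruples m) n ⟩
    sumℤ (map (λ t → (u 𝕂.* summand t) n) (quadruples m)) ≡⟨ FiniteSum.Σ-cong ℤ-ring (quadruples m) term ⟨
    sumℤ (map (λ t → quadrupleTerm t m n) (quadruples m)) ∎
    where
    open ≡.≡-Reasoning
    u : ℤ⟦q⟧
    u = q ^ (triangle m ℕ.+ 1 ℕ.* m)
    term : ∀ {t} → t ∈ quadruples m → quadrupleTerm t m n ≡ (u 𝕂.* summand t) n
    -- A listed quadruple has `xExponent t` equal to `m`, so its term contributes to x^m and carries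
    -- the common weight `u`.
    term {t} t∈ with ≡.trans (≡.sym (weight-xExponent t)) (Enumerates.sound (quadruples-enumerate m) t∈)
    ... | refl = ≡.trans (x^-same (xExponent t) (coefficient t) n) (coefficient≈ t n)

mainTheorem11 : ∃[ S ] (S IsSumOf partitionTerm Over 𝒫) × (S IsSumOf quadrupleTerm Over U)
-- The common value is the weighted series for b = 2, the least part allowed.
mainTheorem11 = A 1 , partition-sum , quadruple-sum
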